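{- There are (families of) multilinear polynomials $f$ and $g$ of $n$ variables, with nonnegative integer coefficients, such that $\mathrm{C}_{0/1}(f)=O(n)$ and $\mathrm{C}_{0/1}(g)=O(n^{3/2})$, but both $\mathrm{C}_{0/1}(f_{\mathrm{he}})$ and $\mathrm{C}_{0/1}(g_{\mathrm{le}})$ are $2^{\Omega(\sqrt{n})}$. Here the asymptotics are as $n\to\infty$.
   Context: All polynomials have nonnegative integer coefficients. A polynomial is multilinear if every variable occurs with exponent $0$ or $1$ in each of its monomials (with nonzero coefficient). A $\{+,\times\}$-circuit is a directed acyclic graph whose input nodes (fanin $0$) are labelled by variables $x_1,\ldots,x_n$ and whose other nodes, called gates, have fanin two and are labelled $+$ or $\times$; its size is the number of gates. Syntactically (formally, expanding by distributivity) the circuit produces at each node a polynomial: $x_i$ at an input $x_i$, and the sum (product) of the polynomials produced at its two inputs at a $+$ ($\times$) gate. The polynomial $F$ produced by the circuit is the one produced at its output. The circuit counts $f(x_1,\dots,x_n)$ if $F(a)=f(a)$ for all $a\in\{0,1\}^n$. $\mathrm{C}_{0/1}(f)$ denotes the minimum size of a $\{+,\times\}$-circuit counting $f$. The degree of a monomial is the sum of the exponents of its variables. The lower envelope $f_{\mathrm{le}}$ of a polynomial $f$ is the polynomial consisting of the monomials of $f$ (with their coefficients) of smallest degree; the higher envelope $f_{\mathrm{he}}$ consists of the monomials of $f$ of largest degree. -}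

module Defs where

open import Data.Bool using (Bool; true; false)
open import Data.Fin using (Fin)
open import Data.Fin.Properties using () renaming (_≟_ to _≟ᶠ_)
open import Data.List using (List; _++_; [_]; map; filter; cartesianProductWith)
open import Data.List.Relation.Unary.All using (all?)
open import Data.Nat using (ℕ; suc; _+_; _*_; _^_; _≤_; _≤?_; _≟_)
open import Data.Nat.ListAction using (sum)
open import Data.Product using (_×_; _,_; proj₁; proj₂; ∃-syntax)
open import Data.Vec as Vec using (Vec)
open import Data.Vec.Properties using (≡-dec)
open import Data.Vec.Relation.Unary.All using (All)
open import Relation.Binary.PropositionalEquality using (_≡_; _≢_)
open import Relation.Nullary using (¬?; does)

-- A monomial in n variables is its vector of exponents.
Monomial : ℕ → Set
Monomial n = Vec ℕ n

degree : ∀ {n} → Monomial n → ℕ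
degree = Vec.sum

-- A polynomial is a formal sum of terms (coefficient , monomial).  Repeated
-- monomials and zero coefficients are allowed in the list, so the coefficients
-- of the polynomial proper are those given by coeff.
Polynomial : ℕ → Set
Polynomial n = List (ℕ × Monomial n)

coeff : ∀ {n} → Polynomial n → Monomial n → ℕ
coeff p μ = sum (map proj₁ (filter (λ t → ≡-dec _≟_ (proj₂ t) μ) p))

monomials : ∀ {n} → Polynomial n → List (Monomial n)
monomials p = filter (λ μ → ¬? (coeff p μ ≟ 0)) (map proj₂ p)

Multilinear : ∀ {n} → Polynomial n → Set
Multilinear p = ∀ μ → coeff p μ ≢ 0 → All (_≤ 1) μ

lowerEnvelope : ∀ {n} → Polynomial n → Polynomial n
lowerEnvelope p = filter (λ t → all? (λ ν → degree (proj₂ t) ≤? degree ν) (monomials p)) p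

higherEnvelope : ∀ {n} → Polynomial n → Polynomial n
higherEnvelope p = filter (λ t → all? (λ ν → degree ν ≤? degree (proj₂ t)) (monomials p)) p

bit : Bool → ℕ
bit false = 0
bit true  = 1

var : ∀ {n} → Fin n → Polynomial n
var i = [ 1 , Vec.tabulate (λ j → bit (does (i ≟ᶠ j))) ]

infixl 6 _⊕_
infixl 7 _⊗_

_⊕_ : ∀ {n} → Polynomial n → Polynomial n → Polynomial n
_⊕_ = _++_

_⊗_ : ∀ {n} → Polynomial n → Polynomial n → Polynomial n
_⊗_ = cartesianProductWith λ (c , μ) (d , ν) → c * d , Vec.zipWith _+_ μ ν

eval : ∀ {n} → Polynomial n → Vec ℕ n → ℕ
eval p a = sum (map (λ (c , μ) → c * Vec.foldr _ _*_ 1 (Vec.zipWith _^_ a μ)) p)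

data Op : Set where
  plus times : Op

⟦_⟧ : ∀ {n} → Op → Polynomial n → Polynomial n → Polynomial n
⟦ plus ⟧  = _⊕_
⟦ times ⟧ = _⊗_

-- The gates of a circuit over n variables, listed in a topological order of
-- the underlying acyclic graph, latest gate first.  Among the s + n nodes
-- available after s gates, the first s are the gates and the last n the inputs
-- x₁ … xₙ.  Both wires of a gate may come from the same node.
data Gates (n : ℕ) : ℕ → Set where
  inputs : Gates n 0
  gate   : ∀ {s} → Op → Fin (s + n) → Fin (s + n) → Gates n s → Gates n (suc s)

nodes : ∀ {n s} → Gates n s → Vec (Polynomial n) (s + n)
nodes inputs          = Vec.tabulate var
nodes (gate op i j G) = ⟦ op ⟧ (Vec.lookup (nodes G) i) (Vec.lookup (nodes G) j) Vec.∷ nodes G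

record Circuit (n : ℕ) : Set where
  field
    size   : ℕ
    gates  : Gates n size
    output : Fin (size + n)

  produced : Polynomial n
  produced = Vec.lookup (nodes gates) output

open Circuit public

infix 4 _Counts_

_Counts_ : ∀ {n} → Circuit n → Polynomial n → Set
_Counts_ {n} C f = ∀ (a : Vec Bool n) → eval (produced C) (Vec.map bit a) ≡ eval f (Vec.map bit a)

-- C₀₁ f Is s: the minimum size of a circuit counting f exists and equals s.
-- It is a relation because circuits have no constants, so that some polynomials
-- (such as 0) are counted by no circuit.
record C₀₁_Is_ {n : ℕ} (f : Polynomial n) (s : ℕ) : Set where
  field
    attained : ∃[ C ] C Counts f × size C ≡ s
    minimal  : ∀ C → C Counts f → s ≤ size C

infix 4 C₀₁_Is_ _≤_·√_ 2^[√_/_]≤_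

Eventually : (ℕ → Set) → Set
Eventually P = ∃[ N ] ∀ n → N ≤ n → P n

-- s ≤ c √m, squared.
_≤_·√_ : ℕ → ℕ → ℕ → Set
s ≤ c ·√ m = s ^ 2 ≤ c ^ 2 * m

-- 2 ^ (√m / k) ≤ s for k > 0: by continuity this says that 2 ^ (p / q) ≤ s ^ k
-- for all rationals p / q ≤ √m.  (The instances with q = 0 are trivial.)
2^[√_/_]≤_ : ℕ → ℕ → ℕ → Set
2^[√ m / k ]≤ s = ∀ p q → p ^ 2 ≤ m * q ^ 2 → 2 ^ p ≤ s ^ (k * q)

{-# OPTIONS --safe #-}
module Submission where

open import Data.Bool using (Bool; true; false; not; _∧_)
import Data.Bool.Properties as Bool
open import Data.Fin using (Fin; zero; suc; _↑ˡ_; _↑ʳ_; combine; inject≤)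
open import Data.Fin.Patterns using (0F; 1F; 2F; 3F; 4F; 5F)
import Data.Fin.Properties as Fin
open import Data.Fin.Subset using (Subset; ∣_∣; ∁; _∪_; ⊤; ⊥; ⁅_⁆; inside; outside; _∉_; _⊆_) renaming (_∈_ to _∈ˢ_)
open import Data.Fin.Subset.Properties using (x∈∁p⇒x∉p; ∣∁p∣≡n∸∣p∣; ∣⊤∣≡n; ∣⊥∣≡0; ∣⁅x⁆∣≡1; x∈⁅x⁆; x∈p∪q⁺; p⊆q⇒∣p∣≤∣q∣)
open import Data.List using ([]; _∷_; _++_; [_]; map; filter)
open import Data.List.Membership.Propositional using (_∈_)
open import Data.List.Membership.Propositional.Properties
  using (∈-++⁻; ∈-++⁺ˡ; ∈-++⁺ʳ; ∈-map⁺; ∈-map⁻; ∈-filter⁺; ∈-filter⁻; ∈-cartesianProductWith⁺; ∈-cartesianProductWith⁻)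
open import Data.List.Properties using (map-++; map-∘; map-cong)
open import Data.List.Relation.Unary.All as ListAll using (all?)
open import Data.List.Relation.Unary.Any using (here; there)
open import Data.Nat
open import Data.Nat.Induction using (<-rec)
open import Data.Nat.ListAction using (sum)
open import Data.Nat.Properties
open import Data.Nat.Tactic.RingSolver using (solve-∀)
open import Data.Product using (Σ; ∃; ∃₂; ∃-syntax; _×_; _,_; proj₁; proj₂)
open import Data.Product.Properties using (,-injective)
open import Data.Sum using (_⊎_; inj₁; inj₂; [_,_]′)
open import Data.Sum.Properties using (inj₁-injective; inj₂-injective)
open import Data.Vec as Vec using (Vec; []; _∷_; lookup; here; there)
open import Data.Vec.Properties
  using (≡-dec; lookup∘tabulate; lookup-map; lookup-zipWith; lookup⇒[]=; []=⇒lookup; zipWith-assoc; zipWith-comm; zipWith-identityʳ)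
open import Data.Vec.Relation.Unary.All using (All; []; _∷_)
open import Function using (_∘_; id; flip)
open import Relation.Binary using () renaming (Decidable to Decidable₂)
open import Relation.Binary.PropositionalEquality hiding ([_])
open import Relation.Nullary using (Dec; yes; no; ¬_; contradiction; ¬?; does)
open import Relation.Nullary.Decidable using (map′; _×-dec_; _⊎-dec_; dec-true; dec-false)
open import Relation.Unary using (Decidable)
open import Defs

open import Algebra.Properties.CommutativeMonoid.Sum +-0-commutativeMonoid
  using (∑-distrib-+) renaming (sum to ∑)
open import Algebra.Properties.CommutativeSemigroup +-commutativeSemigroup using (interchange; x∙yz≈y∙xz)

-- A single family serves as both f and g.  Its variables are t(i,j,c,d) and
-- v(i,j,d) for i, j < m and bits c, d, so that n ≈ 6m², and it is the multilinear
-- polynomial agreeing on the cube with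
--   ∏ᵢ Σ_c ∏ⱼ Σ_d t(i,j,c,d) v(i,j,d)  ·  ∏ⱼ Σ_e ∏ᵢ v(i,j,e),
-- a formula of size O(m²).  A term is given by bits cᵢ, dᵢⱼ, eⱼ.  Its degree is
-- least when the columns repeat only marks of the rows (dᵢⱼ = eⱼ) and greatest
-- when they repeat none (dᵢⱼ = ¬ eⱼ).  In both cases d depends on j only, so the
-- terms of either envelope are indexed by x, y ∈ {0,1}^m, with t(i,j,xᵢ,yⱼ) as
-- the only t-variable of the cell (i,j).
--
-- A circuit counting such an envelope has exactly these supports in its
-- polynomial.  For y = x, follow the term of x from the output down to a gate
-- where its factor contains the t-variables of between m/3 and 2m/3 diagonal
-- cells.  If x and x′ reach the same gate, exchanging the factors shows that for
-- i in the diagonal set P of x and j outside P, x′ agrees with x at i or at j,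
-- hence on P or on the complement of P.  So each gate serves at most two subcubes
-- of codimension m/3, and 2^(m/3 - 1) gates are needed.

private variable
  k m n s : ℕ

-- Terms of formal polynomials

infix 4 _∋_
infixl 7 _∙_

_∋_ : Polynomial n → Monomial n → Set
p ∋ μ = ∃[ c ] (c , μ) ∈ p

_∙_ : Monomial n → Monomial n → Monomial n
_∙_ = Vec.zipWith _+_

-- Nonnegative coefficients never cancel, so once zero terms are excluded, being listed (`_∋_`) and
-- having a nonzero coefficient are the same.
Positive : Polynomial n → Set
Positive p = ∀ {c μ} → (c , μ) ∈ p → 0 < c

⊕∋⁻ : ∀ (p q : Polynomial n) {μ} → p ⊕ q ∋ μ → p ∋ μ ⊎ q ∋ μ
⊕∋⁻ p q (c , h) with ∈-++⁻ p h
... | inj₁ h₁ = inj₁ (c , h₁)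
... | inj₂ h₂ = inj₂ (c , h₂)

⊕∋⁺ˡ : ∀ (p q : Polynomial n) {μ} → p ∋ μ → p ⊕ q ∋ μ
⊕∋⁺ˡ p q (c , h) = c , ∈-++⁺ˡ h

⊕∋⁺ʳ : ∀ (p q : Polynomial n) {μ} → q ∋ μ → p ⊕ q ∋ μ
⊕∋⁺ʳ p q (c , h) = c , ∈-++⁺ʳ p h

⊗∋⁺ : ∀ (p q : Polynomial n) {μ ν} → p ∋ μ → q ∋ ν → p ⊗ q ∋ μ ∙ ν
⊗∋⁺ p q (_ , h) (_ , k) = _ , ∈-cartesianProductWith⁺ _ h k

⊗∋⁻ : ∀ (p q : Polynomial n) {μ} → p ⊗ q ∋ μ → ∃₂ λ μ₁ μ₂ → p ∋ μ₁ × q ∋ μ₂ × μ ≡ μ₁ ∙ μ₂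
⊗∋⁻ p q (_ , h) with ∈-cartesianProductWith⁻ _ p q h
... | _ , _ , h₁ , h₂ , refl = _ , _ , (_ , h₁) , (_ , h₂) , refl

positive-⟦⟧ : ∀ o {p q : Polynomial n} → Positive p → Positive q → Positive (⟦ o ⟧ p q)
positive-⟦⟧ plus {p} P Q h with ∈-++⁻ p h
... | inj₁ h₁ = P h₁
... | inj₂ h₂ = Q h₂
positive-⟦⟧ times {p} {q} P Q h with ∈-cartesianProductWith⁻ _ p q h
... | _ , _ , h₁ , h₂ , refl = *-mono-< (P h₁) (Q h₂)

positive-var : (i : Fin n) → Positive (var i)
positive-var i (here refl) = s≤s z≤n

lookup-∙ : ∀ (μ ν : Monomial n) v → lookup (μ ∙ ν) v ≡ lookup μ v + lookup ν v
lookup-∙ μ ν v = lookup-zipWith _+_ v μ ν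

degree-∙ : ∀ (μ ν : Monomial n) → degree (μ ∙ ν) ≡ degree μ + degree ν
degree-∙ []      []      = refl
degree-∙ (d ∷ μ) (e ∷ ν) = trans (cong (d + e +_) (degree-∙ μ ν)) (interchange d e (degree μ) (degree ν))

-- Formulas and the circuits computing them

data Formula (n : ℕ) : Set where
  leaf : Fin n → Formula n
  node : Op → Formula n → Formula n → Formula n

poly : Formula n → Polynomial n
poly (leaf i)     = var i
poly (node o d e) = ⟦ o ⟧ (poly d) (poly e)

leaves : Formula n → ℕ
leaves (leaf i)     = 1
leaves (node o d e) = leaves d + leaves e

positive-poly : (e : Formula n) → Positive (poly e)
positive-poly (leaf i)     = positive-var i
positive-poly (node o d e) = positive-⟦⟧ o (positive-poly d) (positive-poly e)

-- Keeping at each `plus` node only the summand that the term comes from leaves a pure product,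
-- whose expansion is that single term.
parseTree : ∀ (e : Formula n) {c μ} → (c , μ) ∈ poly e → ∃[ d ] poly d ≡ [ c , μ ]
parseTree (leaf i)         (here refl) = leaf i , refl
parseTree (node plus d e)  h with ∈-++⁻ (poly d) h
... | inj₁ h₁ = parseTree d h₁
... | inj₂ h₂ = parseTree e h₂
parseTree (node times d e) h with ∈-cartesianProductWith⁻ _ (poly d) (poly e) h
... | _ , _ , h₁ , h₂ , refl with parseTree d h₁ | parseTree e h₂
... | d′ , eq₁ | e′ , eq₂ = node times d′ e′ , cong₂ _⊗_ eq₁ eq₂

positive-nodes : (G : Gates n s) (i : Fin (s + n)) → Positive (lookup (nodes G) i)
positive-nodes inputs         i rewrite lookup∘tabulate var i = positive-var i
positive-nodes (gate o i j G) zero    = positive-⟦⟧ o (positive-nodes G i) (positive-nodes G j)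
positive-nodes (gate o i j G) (suc k) = positive-nodes G k

lookup-input : (G : Gates n s) (i : Fin n) → lookup (nodes G) (s ↑ʳ i) ≡ var i
lookup-input inputs         i = lookup∘tabulate var i
lookup-input (gate o _ _ G) i = lookup-input G i

-- New gates shift the indices of all nodes, so `old` relocates the earlier ones. A formula with k
-- leaves costs k - 1 gates; `size≡` says so without subtraction.
record Extension (G : Gates n s) (p : Polynomial n) (k : ℕ) : Set where
  field
    {size′} : ℕ
    gates′  : Gates n size′
    out     : Fin (size′ + n)
    old     : Fin (s + n) → Fin (size′ + n)
    out≡    : lookup (nodes gates′) out ≡ p
    old≡    : ∀ i → lookup (nodes gates′) (old i) ≡ lookup (nodes G) i
    size≡   : suc size′ ≡ k + s

extend : (e : Formula n) (G : Gates n s) → Extension G (poly e) (leaves e)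
extend {s = s} (leaf i) G = record
  { gates′ = G ; out = s ↑ʳ i ; old = id ; out≡ = lookup-input G i ; old≡ = λ _ → refl ; size≡ = refl }
extend {s = s} (node o d e) G = record
  { gates′ = gate o (E₂.old E₁.out) E₂.out E₂.gates′
  ; out    = zero
  ; old    = λ i → suc (E₂.old (E₁.old i))
  ; out≡   = cong₂ ⟦ o ⟧ (trans (E₂.old≡ E₁.out) E₁.out≡) E₂.out≡
  ; old≡   = λ i → trans (E₂.old≡ _) (E₁.old≡ i)
  ; size≡  = size-eq
  }
  where
  module E₁ = Extension (extend d G)
  module E₂ = Extension (extend e E₁.gates′)
  open ≡-Reasoning
  size-eq : suc (suc E₂.size′) ≡ leaves d + leaves e + s
  size-eq = begin
    suc (suc E₂.size′)          ≡⟨ cong suc E₂.size≡ ⟩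
    suc (leaves e + E₁.size′)   ≡⟨ +-suc (leaves e) _ ⟨
    leaves e + suc E₁.size′     ≡⟨ cong (leaves e +_) E₁.size≡ ⟩
    leaves e + (leaves d + s)   ≡⟨ +-assoc (leaves e) _ _ ⟨
    leaves e + leaves d + s     ≡⟨ cong (_+ s) (+-comm (leaves e) _) ⟩
    leaves d + leaves e + s     ∎

circuit : Formula n → Circuit n
circuit e = record { size = size′ ; gates = gates′ ; output = out }
  where open Extension (extend e inputs)

produced-circuit : (e : Formula n) → produced (circuit e) ≡ poly e
produced-circuit e = Extension.out≡ (extend e inputs)

size-circuit : (e : Formula n) → size (circuit e) ≤ leaves e
size-circuit e = ≤-trans (n≤1+n _) (≤-reflexive (trans size≡ (+-identityʳ _)))
  where open Extension (extend e inputs)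

-- Existence of minimal circuits

decideOp : {P : Op → Set} → Decidable P → Dec (∃ P)
decideOp P? = map′ (λ { (inj₁ p) → plus , p ; (inj₂ p) → times , p })
                   (λ { (plus , p) → inj₁ p ; (times , p) → inj₂ p })
                   (P? plus ⊎-dec P? times)

-- Gate lists of a given size are finite in number, so exhaustive search decides. This makes the
-- minimum size exist constructively.
decideGates : ∀ s {P : Gates n s → Set} → Decidable P → Dec (∃ P)
decideGates zero P? = map′ (inputs ,_) (λ { (inputs , p) → p }) (P? inputs)
decideGates (suc s) P? =
  map′ (λ (o , i , j , G , p) → gate o i j G , p)
       (λ { (gate o i j G , p) → o , i , j , G , p })
       (decideOp λ o → Fin.any? λ i → Fin.any? λ j → decideGates s λ G → P? (gate o i j G))

decideCube : ∀ n {P : Vec Bool n → Set} → Decidable P → Dec (∀ a → P a)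
decideCube zero    P? = map′ (λ { p [] → p }) (λ p → p []) (P? [])
decideCube (suc n) P? =
  map′ (λ { (p , q) (false ∷ a) → p a ; (p , q) (true ∷ a) → q a })
       (λ p → p ∘ (false ∷_) , p ∘ (true ∷_))
       (decideCube n (P? ∘ (false ∷_)) ×-dec decideCube n (P? ∘ (true ∷_)))

CountedInSize : Polynomial n → ℕ → Set
CountedInSize f s = ∃[ C ] C Counts f × size C ≡ s

countedInSize? : (f : Polynomial n) → Decidable (CountedInSize f)
countedInSize? {n} f s =
  map′ (λ (G , o , h) → record { size = s ; gates = G ; output = o } , h , refl)
       (λ { (C , h , refl) → gates C , output C , h })
       (decideGates s λ G → Fin.any? λ o → decideCube n λ a → _ ≟ _)

least : ∀ {P : ℕ → Set} → Decidable P → ∀ k → P k →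
        ∃[ l ] P l × l ≤ k × (∀ j → P j → l ≤ j)
least {P} P? = <-rec _ step
  where
  step : ∀ k → (∀ {j} → j < k → P j → ∃[ l ] P l × l ≤ j × (∀ i → P i → l ≤ i)) →
         P k → ∃[ l ] P l × l ≤ k × (∀ j → P j → l ≤ j)
  step k rec p with anyUpTo? P? k
  ... | no ¬q = k , p , ≤-refl , λ j q → ≮⇒≥ λ j<k → ¬q (j , j<k , q)
  ... | yes (j , j<k , q) with rec j<k q
  ... | l , pl , l≤j , min = l , pl , ≤-trans l≤j (<⇒≤ j<k) , min

-- One explicit circuit yields both the existence of the minimum and an upper bound on it.
minimalSize : ∀ (f : Polynomial n) C → C Counts f → ∃[ s ] (C₀₁ f Is s) × s ≤ size C
minimalSize f C h with least (countedInSize? f) (size C) (C , h , refl)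
... | s , at , s≤ , min =
  s , record { attained = at ; minimal = λ D k → min (size D) (D , k , refl) } , s≤

-- Multilinear representatives on the cube

clip : Monomial n → Monomial n
clip = Vec.map (1 ⊓_)

-- Terms that become equal stay separate entries, which `coeff` adds up.
multilinearize : Polynomial n → Polynomial n
multilinearize = map λ (c , μ) → c , clip μ

clip≤1 : (μ : Monomial n) → All (_≤ 1) (clip μ)
clip≤1 []      = []
clip≤1 (e ∷ μ) = m⊓n≤m 1 e ∷ clip≤1 μ

multilinearize∋⁻ : ∀ (p : Polynomial n) {μ} → multilinearize p ∋ μ → ∃[ ν ] p ∋ ν × μ ≡ clip ν
multilinearize∋⁻ p (_ , h) with ∈-map⁻ _ h
... | _ , k , refl = _ , (_ , k) , refl

multilinearize∋⁺ : ∀ (p : Polynomial n) {μ} → p ∋ μ → multilinearize p ∋ clip μ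
multilinearize∋⁺ p (_ , h) = _ , ∈-map⁺ _ h

positive-multilinearize : ∀ (p : Polynomial n) → Positive p → Positive (multilinearize p)
positive-multilinearize p P h with ∈-map⁻ _ h
... | _ , k , refl = P k

coeff≢0⇒∋ : ∀ (p : Polynomial n) μ → coeff p μ ≢ 0 → p ∋ μ
coeff≢0⇒∋ []            μ h = contradiction refl h
coeff≢0⇒∋ ((c , ν) ∷ p) μ h with ≡-dec _≟_ ν μ
... | yes refl = c , here refl
... | no _     = let d , k = coeff≢0⇒∋ p μ h in d , there k

∋⇒coeff≢0 : ∀ (p : Polynomial n) {μ} → Positive p → p ∋ μ → coeff p μ ≢ 0
∋⇒coeff≢0 p {μ} P (c , h) = m<n⇒n≢0 (≤-trans (P h) (term≤coeff p h))
  where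
  term≤coeff : ∀ p → (c , μ) ∈ p → c ≤ coeff p μ
  term≤coeff ((d , ν) ∷ p) h with ≡-dec _≟_ ν μ | h
  ... | yes _ | here refl = m≤m+n _ _
  ... | yes _ | there k   = ≤-trans (term≤coeff p k) (m≤n+m _ _)
  ... | no ne | here refl = contradiction refl ne
  ... | no _  | there k   = term≤coeff p k

multilinear-multilinearize : (p : Polynomial n) → Multilinear (multilinearize p)
multilinear-multilinearize p μ h with multilinearize∋⁻ p (coeff≢0⇒∋ _ μ h)
... | ν , _ , refl = clip≤1 ν

bits : Vec Bool n → Vec ℕ n
bits = Vec.map bit

-- A bit equals each of its positive powers.
eval-multilinearize : ∀ (p : Polynomial n) a → eval (multilinearize p) (bits a) ≡ eval p (bits a)
eval-multilinearize p a = cong sum (trans (sym (map-∘ p)) (map-cong (λ (c , μ) → cong (c *_) (power-clip a μ)) p))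
  where
  bit^clip : ∀ b e → bit b ^ (1 ⊓ e) ≡ bit b ^ e
  bit^clip b     zero    = refl
  bit^clip false (suc e) = refl
  bit^clip true  (suc e) = sym (^-zeroˡ (suc e))
  power-clip : ∀ {n} (a : Vec Bool n) μ →
    Vec.foldr (λ _ → ℕ) _*_ 1 (Vec.zipWith _^_ (bits a) (clip μ)) ≡
    Vec.foldr (λ _ → ℕ) _*_ 1 (Vec.zipWith _^_ (bits a) μ)
  power-clip []      []      = refl
  power-clip (b ∷ a) (e ∷ μ) = cong₂ _*_ (bit^clip b e) (power-clip a μ)

-- Adding up the parse trees of the listed terms gives the formula. With `e` the grid formula this
-- shows that the envelopes are counted by some circuit at all; the list is nonempty because no
-- formula produces 0.
sumOfTerms : ∀ (e : Formula n) t h → (∀ {u} → u ∈ t ∷ h → u ∈ multilinearize (poly e)) →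
             ∃[ d ] multilinearize (poly d) ≡ t ∷ h
sumOfTerms e t [] h⊆ with ∈-map⁻ _ (h⊆ (here refl))
... | _ , k , refl with parseTree e k
... | d , eq = d , cong multilinearize eq
sumOfTerms e t (u ∷ h) h⊆ with sumOfTerms e t [] (λ { (here refl) → h⊆ (here refl) }) | sumOfTerms e u h (h⊆ ∘ there)
... | d₁ , eq₁ | d₂ , eq₂ = node plus d₁ d₂ , trans (map-++ _ (poly d₁) (poly d₂)) (cong₂ _++_ eq₁ eq₂)

circuit-counts : ∀ (e : Formula n) → circuit e Counts multilinearize (poly e)
circuit-counts e a rewrite produced-circuit e = sym (eval-multilinearize (poly e) a)

-- Envelopes for an arbitrary order on degrees

module Envelope {_≼_ : ℕ → ℕ → Set} (_≼?_ : Decidable₂ _≼_) where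

  -- Taking `_≼_` to be ≤ or ≥ gives `lowerEnvelope` or `higherEnvelope` by definition.
  envelope : Polynomial n → Polynomial n
  envelope p = filter (λ t → all? (λ ν → degree (proj₂ t) ≼? degree ν) (monomials p)) p

  ∈-envelope⁻ : ∀ (p : Polynomial n) {t} → Positive p → t ∈ envelope p →
                t ∈ p × (∀ {ν} → p ∋ ν → degree (proj₂ t) ≼ degree ν)
  ∈-envelope⁻ p P h with ∈-filter⁻ (λ t → all? (λ ν → degree (proj₂ t) ≼? degree ν) (monomials p)) {xs = p} h
  ... | t∈p , extremal = t∈p , λ k → ListAll.lookup extremal
    (∈-filter⁺ (λ μ → ¬? (coeff p μ ≟ 0)) (∈-map⁺ proj₂ (proj₂ k)) (∋⇒coeff≢0 p P k))

  ∈-envelope⁺ : ∀ (p : Polynomial n) {t} → t ∈ p → (∀ {ν} → p ∋ ν → degree (proj₂ t) ≼ degree ν) →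
                t ∈ envelope p
  ∈-envelope⁺ p t∈p extremal = ∈-filter⁺ _ t∈p (ListAll.tabulate λ {ν} k →
    extremal (coeff≢0⇒∋ p ν (proj₂ (∈-filter⁻ (λ μ → ¬? (coeff p μ ≟ 0)) {xs = map proj₂ p} k))))

-- A multilinear polynomial is determined by its values on the cube

-- The coefficient of the e-th power of the first variable, as a polynomial in the remaining ones.
strip : ℕ → Polynomial (suc n) → Polynomial n
strip e p = map (λ (c , μ) → c , Vec.tail μ) (filter (λ t → Vec.head (proj₂ t) ≟ e) p)

-- Unlike `Multilinear`, this also constrains listed terms with coefficient zero, and so passes to
-- sublists.
Multilinearᵗ : Polynomial n → Set
Multilinearᵗ p = ∀ {μ} → p ∋ μ → All (_≤ 1) μ

coeff-strip : ∀ (p : Polynomial (suc n)) e μ → coeff p (e ∷ μ) ≡ coeff (strip e p) μ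
coeff-strip []                e μ = refl
-- Both filters decide `d ≟ e` through this Boolean, so splitting on it reduces both sides.
coeff-strip ((c , d ∷ ν) ∷ p) e μ with d ≡ᵇ e
... | false = coeff-strip p e μ
... | true with does (≡-dec _≟_ ν μ)
...   | true  = cong (c +_) (coeff-strip p e μ)
...   | false = coeff-strip p e μ

strip-multilinear : ∀ (p : Polynomial (suc n)) e → Multilinearᵗ p → Multilinearᵗ (strip e p)
strip-multilinear p e M (_ , h) with ∈-map⁻ _ h
... | (_ , _ ∷ _) , k , refl with M (_ , proj₁ (∈-filter⁻ (λ t → Vec.head (proj₂ t) ≟ e) {xs = p} k))
... | _ ∷ ≤1 = ≤1

eval-strip₀ : ∀ (p : Polynomial (suc n)) a → eval p (0 ∷ a) ≡ eval (strip 0 p) a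
eval-strip₀ []                    a = refl
eval-strip₀ ((c , zero  ∷ μ) ∷ p) a = cong₂ _+_ (cong (c *_) (+-identityʳ _)) (eval-strip₀ p a)
eval-strip₀ ((c , suc e ∷ μ) ∷ p) a rewrite *-zeroʳ c = eval-strip₀ p a

eval-strip₁ : ∀ (p : Polynomial (suc n)) a → Multilinearᵗ p →
              eval p (1 ∷ a) ≡ eval (strip 0 p) a + eval (strip 1 p) a
eval-strip₁ []                a M = refl
eval-strip₁ ((c , e ∷ μ) ∷ p) a M with M (c , here refl)
... | z≤n ∷ _ = trans (cong₂ _+_ (cong (c *_) (+-identityʳ x)) (eval-strip₁ p a (λ (d , h) → M (d , there h))))
                      (sym (+-assoc (c * x) (eval (strip 0 p) a) (eval (strip 1 p) a)))
  where x = Vec.foldr (λ _ → ℕ) _*_ 1 (Vec.zipWith _^_ a μ)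
... | s≤s z≤n ∷ _ = trans (cong₂ _+_ (cong (c *_) (+-identityʳ x)) (eval-strip₁ p a (λ (d , h) → M (d , there h))))
                          (x∙yz≈y∙xz (c * x) (eval (strip 0 p) a) (eval (strip 1 p) a))
  where
  x = Vec.foldr (λ _ → ℕ) _*_ 1 (Vec.zipWith _^_ a μ)

-- Induction on the variables: the values at 0 of the first variable determine the part free of it,
-- and subtracting them from the values at 1 determines its cofactor.
coeff-determined : ∀ (p q : Polynomial n) → Multilinearᵗ p → Multilinearᵗ q →
                   (∀ a → eval p (bits a) ≡ eval q (bits a)) →
                   ∀ {μ} → All (_≤ 1) μ → coeff p μ ≡ coeff q μ
coeff-determined p q M N eq {[]} [] = trans (sym (value p)) (trans (eq []) (value q))
  where
  value : ∀ (p : Polynomial 0) → eval p [] ≡ coeff p []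
  value []             = refl
  value ((c , []) ∷ p) = cong₂ _+_ (*-identityʳ c) (value p)
coeff-determined p q M N eq {e ∷ μ} (e≤1 ∷ μ≤1) =
  trans (coeff-strip p e μ) (trans (by-head e≤1) (sym (coeff-strip q e μ)))
  where
  eq₀ : ∀ a → eval (strip 0 p) (bits a) ≡ eval (strip 0 q) (bits a)
  eq₀ a = trans (sym (eval-strip₀ p _)) (trans (eq (false ∷ a)) (eval-strip₀ q _))
  eq₁ : ∀ a → eval (strip 1 p) (bits a) ≡ eval (strip 1 q) (bits a)
  eq₁ a = +-cancelˡ-≡ (eval (strip 0 p) (bits a)) _ _
    (trans (sym (eval-strip₁ p _ M)) (trans (eq (true ∷ a))
      (trans (eval-strip₁ q _ N) (cong (_+ eval (strip 1 q) (bits a)) (sym (eq₀ a))))))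
  by-head : ∀ {e} → e ≤ 1 → coeff (strip e p) μ ≡ coeff (strip e q) μ
  by-head z≤n       = coeff-determined _ _ (strip-multilinear p 0 M) (strip-multilinear q 0 N) eq₀ μ≤1
  by-head (s≤s z≤n) = coeff-determined _ _ (strip-multilinear p 1 M) (strip-multilinear q 1 N) eq₁ μ≤1

-- A circuit may produce higher powers than the polynomial it counts, so only clipped monomials can
-- be compared; those are fixed by the values on the cube.
sameSupports : ∀ (p q : Polynomial n) → (∀ a → eval p (bits a) ≡ eval q (bits a)) → Positive p →
               ∀ {μ} → p ∋ μ → ∃[ ν ] q ∋ ν × clip μ ≡ clip ν
sameSupports p q eq P {μ} h = multilinearize∋⁻ q (coeff≢0⇒∋ _ _ (subst (_≢ 0) coeff-eq coeff≢0))
  where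
  coeff-eq : coeff (multilinearize p) (clip μ) ≡ coeff (multilinearize q) (clip μ)
  coeff-eq = coeff-determined _ _ (multilinearᵗ p) (multilinearᵗ q)
    (λ a → trans (eval-multilinearize p a) (trans (eq a) (sym (eval-multilinearize q a)))) (clip≤1 μ)
    where
    multilinearᵗ : ∀ p → Multilinearᵗ (multilinearize p)
    multilinearᵗ p k with multilinearize∋⁻ p k
    ... | ν , _ , refl = clip≤1 ν
  coeff≢0 : coeff (multilinearize p) (clip μ) ≢ 0
  coeff≢0 = ∋⇒coeff≢0 _ (positive-multilinearize p P) (multilinearize∋⁺ p h)

clip-nonzero : ∀ {μ ν : Monomial n} → clip μ ≡ clip ν → ∀ v → lookup μ v ≢ 0 → lookup ν v ≢ 0
clip-nonzero {μ = μ} {ν} eq v μv≢0 νv≡0 = μv≢0 (zero-clip (trans (sym (lookup-map v _ μ))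
    (trans (cong (λ ξ → lookup ξ v) eq) (trans (lookup-map v _ ν) (cong (1 ⊓_) νv≡0)))))
  where
  zero-clip : ∀ {e} → 1 ⊓ e ≡ 0 → e ≡ 0
  zero-clip {zero} _ = refl

term≤∑ : ∀ (f : Fin n → ℕ) i → f i ≤ ∑ f
term≤∑ f zero    = m≤m+n _ _
term≤∑ f (suc i) = ≤-trans (term≤∑ (f ∘ suc) i) (m≤n+m _ _)

-- Covering the cube

count : (Vec Bool m → Bool) → ℕ
count {zero}  p = bit (p [])
count {suc m} p = count (p ∘ (false ∷_)) + count (p ∘ (true ∷_))

count-empty : ∀ m → count {m} (λ _ → false) ≡ 0
count-empty zero    = refl
count-empty (suc m) = cong₂ _+_ (count-empty m) (count-empty m)

count-union : ∀ (p q r : Vec Bool m → Bool) → (∀ x → p x ≡ true → q x ≡ true ⊎ r x ≡ true) →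
              count p ≤ count q + count r
count-union {zero} p q r h with p [] | h []
... | false | _ = z≤n
... | true  | k with k refl
...   | inj₁ eq rewrite eq = s≤s z≤n
...   | inj₂ eq rewrite eq = m≤n+m 1 _
count-union {suc m} p q r h = ≤-trans
  (+-mono-≤ (count-union _ (q ∘ (false ∷_)) (r ∘ (false ∷_)) (h ∘ (false ∷_)))
            (count-union _ (q ∘ (true ∷_)) (r ∘ (true ∷_)) (h ∘ (true ∷_))))
  (≤-reflexive (interchange (count (q ∘ (false ∷_))) _ _ _))

inhabited⊎empty : ∀ (p : Vec Bool m → Bool) → (∃[ x ] p x ≡ true) ⊎ count p ≡ 0
inhabited⊎empty {zero} p with p [] in eq
... | true  = inj₁ ([] , eq)
... | false = inj₂ refl
inhabited⊎empty {suc m} p with inhabited⊎empty (p ∘ (false ∷_)) | inhabited⊎empty (p ∘ (true ∷_))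
... | inj₁ (x , px) | _             = inj₁ (false ∷ x , px)
... | inj₂ _        | inj₁ (x , px) = inj₁ (true ∷ x , px)
... | inj₂ eq₀      | inj₂ eq₁      = inj₂ (cong₂ _+_ eq₀ eq₁)

class : (Vec Bool m → Fin s) → Fin s → Vec Bool m → Bool
class col g x = does (col x Fin.≟ g)

-- Each point of the cube is counted in the class of its own colour.
sum-classes : ∀ (col : Vec Bool m → Fin s) → 2 ^ m ≤ ∑ (λ g → count (class col g))
sum-classes {zero} col = ≤-trans
  (≤-reflexive (cong bit (sym (dec-true (col [] Fin.≟ col []) refl))))
  (term≤∑ (λ g → bit (class col g [])) (col []))
sum-classes {suc m} col = ≤-trans
  (+-mono-≤ (sum-classes (col ∘ (false ∷_)))
            (≤-trans (≤-reflexive (+-identityʳ (2 ^ m))) (sum-classes (col ∘ (true ∷_)))))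
  (≤-reflexive (sym (∑-distrib-+ (λ g → count (class (col ∘ (false ∷_)) g)) _)))

-- As a predicate of its last argument, this is the subcube through the second one whose fixed
-- coordinates are P.
agrees : Subset m → Vec Bool m → Vec Bool m → Bool
agrees []            []      []      = true
agrees (inside  ∷ P) (b ∷ x) (c ∷ y) = does (b Bool.≟ c) ∧ agrees P x y
agrees (outside ∷ P) (b ∷ x) (c ∷ y) = agrees P x y

agrees⁺ : ∀ (P : Subset m) x y → (∀ i → i ∈ˢ P → lookup y i ≡ lookup x i) → agrees P x y ≡ true
agrees⁺ []            []      []      h = refl
agrees⁺ (inside  ∷ P) (b ∷ x) (c ∷ y) h
  rewrite dec-true (b Bool.≟ c) (sym (h zero here)) = agrees⁺ P x y (λ i → h (suc i) ∘ there)
agrees⁺ (outside ∷ P) (b ∷ x) (c ∷ y) h = agrees⁺ P x y (λ i → h (suc i) ∘ there)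

disagreement : ∀ (P : Subset m) x y → agrees P x y ≡ false → ∃[ i ] i ∈ˢ P × lookup y i ≢ lookup x i
disagreement []            []      []      ()
disagreement (inside  ∷ P) (b ∷ x) (c ∷ y) eq with b Bool.≟ c
... | no b≢c = zero , here , b≢c ∘ sym
... | yes _ with disagreement P x y eq
...   | i , i∈P , ne = suc i , there i∈P , ne
disagreement (outside ∷ P) (b ∷ x) (c ∷ y) eq with disagreement P x y eq
... | i , i∈P , ne = suc i , there i∈P , ne

-- A coordinate outside P doubles the subcube and one inside P leaves its size unchanged. The
-- product form avoids subtracting in the exponent.
count-agrees : ∀ (P : Subset m) x → 2 ^ ∣ P ∣ * count (agrees P x) ≡ 2 ^ m
count-agrees []            []          = refl
count-agrees {suc m} (outside ∷ P) (b ∷ x) = begin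
  2 ^ ∣ P ∣ * (c + c)             ≡⟨ double (2 ^ ∣ P ∣) c ⟩
  2 * (2 ^ ∣ P ∣ * c)             ≡⟨ cong (2 *_) (count-agrees P x) ⟩
  2 * 2 ^ m                       ∎
  where
  open ≡-Reasoning
  c = count (agrees P x)
  double : ∀ a c → a * (c + c) ≡ 2 * (a * c)
  double = solve-∀
count-agrees {suc m} (inside ∷ P) (b ∷ x) = begin
  2 * 2 ^ ∣ P ∣ * count (agrees (inside ∷ P) (b ∷ x))  ≡⟨ cong (2 * 2 ^ ∣ P ∣ *_) (fixed b) ⟩
  2 * 2 ^ ∣ P ∣ * count (agrees P x)                   ≡⟨ *-assoc 2 (2 ^ ∣ P ∣) _ ⟩
  2 * (2 ^ ∣ P ∣ * count (agrees P x))                 ≡⟨ cong (2 *_) (count-agrees P x) ⟩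
  2 * 2 ^ m                                            ∎
  where
  open ≡-Reasoning
  fixed : ∀ b → count (agrees (inside ∷ P) (b ∷ x)) ≡ count (agrees P x)
  fixed false = trans (cong (count (agrees P x) +_) (count-empty m)) (+-identityʳ _)
  fixed true  = cong (_+ count (agrees P x)) (count-empty m)

count-agrees-≤ : ∀ t (P : Subset m) x → t ≤ ∣ P ∣ → 2 ^ t * count (agrees P x) ≤ 2 ^ m
count-agrees-≤ t P x t≤ = ≤-trans (*-monoˡ-≤ _ (^-monoʳ-≤ 2 t≤)) (≤-reflexive (count-agrees P x))

-- A member y of the class of x agrees with x on all of P x or on all of its
-- complement, so the class is covered by two subcubes of codimension t.
cover : ∀ t (col : Vec Bool m → Fin s) (P : Vec Bool m → Subset m) →
        (∀ x → t ≤ ∣ P x ∣) → (∀ x → t ≤ ∣ ∁ (P x) ∣) →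
        (∀ x y → col x ≡ col y → ∀ i j → i ∈ˢ P x → j ∉ P x →
           lookup y i ≡ lookup x i ⊎ lookup y j ≡ lookup x j) →
        2 ^ t ≤ s * 2
cover {m} {s} t col P P≥ ∁P≥ compat = *-cancelʳ-≤ (2 ^ t) (s * 2) (2 ^ m) {{m^n≢0 2 m}} (begin
  2 ^ t * 2 ^ m                                ≤⟨ *-monoʳ-≤ (2 ^ t) (sum-classes col) ⟩
  2 ^ t * ∑ (λ g → count (class col g))      ≤⟨ *-sum-bound (2 ^ t) (λ g → count (class col g)) class-bound ⟩
  s * (2 * 2 ^ m)                              ≡⟨ *-assoc s 2 _ ⟨
  s * 2 * 2 ^ m                                ∎)
  where
  open ≤-Reasoning
  *-sum-bound : ∀ {s k} a (f : Fin s → ℕ) → (∀ g → a * f g ≤ k) → a * ∑ f ≤ s * k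
  *-sum-bound {zero}  a f h = ≤-reflexive (*-zeroʳ a)
  *-sum-bound {suc s} a f h = ≤-trans (≤-reflexive (*-distribˡ-+ a (f zero) _))
                                      (+-mono-≤ (h zero) (*-sum-bound a (f ∘ suc) (h ∘ suc)))
  same : ∀ x y → col x ≡ col y → agrees (P x) x y ≡ true ⊎ agrees (∁ (P x)) x y ≡ true
  same x y eq with agrees (P x) x y in ag
  ... | true = inj₁ refl
  -- A single disagreement at some i in P forces, through `compat`, agreement at every j outside P.
  ... | false with disagreement (P x) x y ag
  ...   | i , i∈P , ne = inj₂ (agrees⁺ (∁ (P x)) x y λ j j∈∁P →
            [ (λ eqᵢ → contradiction eqᵢ ne) , id ]′ (compat x y eq i j i∈P (x∈∁p⇒x∉p j∈∁P)))
  class-bound : ∀ g → 2 ^ t * count (class col g) ≤ 2 * 2 ^ m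
  class-bound g with inhabited⊎empty (class col g)
  ... | inj₂ empty rewrite empty | *-zeroʳ (2 ^ t) = z≤n
  ... | inj₁ (x , x∈g) = begin
    2 ^ t * count (class col g)
      ≤⟨ *-monoʳ-≤ (2 ^ t) (count-union (class col g) (agrees (P x) x) (agrees (∁ (P x)) x)
           λ y y∈g → same x y (trans (class⁻ x x∈g) (sym (class⁻ y y∈g)))) ⟩
    2 ^ t * (count (agrees (P x) x) + count (agrees (∁ (P x)) x))
      ≡⟨ *-distribˡ-+ (2 ^ t) (count (agrees (P x) x)) _ ⟩
    2 ^ t * count (agrees (P x) x) + 2 ^ t * count (agrees (∁ (P x)) x)
      ≤⟨ +-mono-≤ (count-agrees-≤ t (P x) x (P≥ x)) (count-agrees-≤ t (∁ (P x)) x (∁P≥ x)) ⟩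
    2 ^ m + 2 ^ m
      ≡⟨ cong (2 ^ m +_) (+-identityʳ (2 ^ m)) ⟨
    2 * 2 ^ m ∎
    where
    class⁻ : ∀ y → class col g y ≡ true → col y ≡ g
    class⁻ y h with col y Fin.≟ g
    ... | yes eq = eq

-- Balanced gates

∙-assoc : (μ ν ξ : Monomial n) → (μ ∙ ν) ∙ ξ ≡ μ ∙ (ν ∙ ξ)
∙-assoc = zipWith-assoc +-assoc

∙-comm : (μ ν : Monomial n) → μ ∙ ν ≡ ν ∙ μ
∙-comm = zipWith-comm +-comm

one : Monomial n
one = Vec.replicate _ 0

∙-identityʳ : (μ : Monomial n) → μ ∙ one ≡ μ
∙-identityʳ = zipWith-identityʳ +-identityʳ

gatePoly : Gates n s → Fin s → Polynomial n
gatePoly {n} G g = lookup (nodes G) (g ↑ˡ n)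

-- A gate g and a factorisation μ = inner ∙ outer witnessing that μ is produced
-- through g: whatever g produces can be put in place of inner.
record Through (τ : Monomial n → ℕ) (t : ℕ) (G : Gates n s) (p : Polynomial n) (μ : Monomial n) : Set where
  field
    at       : Fin s
    inner    : Monomial n
    outer    : Monomial n
    produces : gatePoly G at ∋ inner
    heavy    : t ≤ τ inner
    light    : τ inner < 2 * t
    factors  : μ ≡ inner ∙ outer
    replace  : ∀ {ν} → gatePoly G at ∋ ν → p ∋ ν ∙ outer

module Descent (τ : Monomial n → ℕ) (t : ℕ)
  (τ-∙ : ∀ μ ν → τ (μ ∙ ν) ≤ τ μ + τ ν)
  (τ-var : ∀ i {μ} → var i ∋ μ → τ μ < t) where

  weaken : ∀ {G : Gates n s} {p q μ} o i j → Through τ t G p μ → (∀ {ν} → p ∋ ν → q ∋ ν) →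
           Through τ t (gate o i j G) q μ
  weaken o i j T p⊆q = record
    { at = suc at ; inner = inner ; outer = outer ; produces = produces
    ; heavy = heavy ; light = light ; factors = factors ; replace = λ h → p⊆q (replace h) }
    where open Through T

  -- Passing a product gate through one factor moves the other factor into the outer part, which
  -- keeps the exchange property.
  multiply : ∀ {G : Gates n s} {p q μ} i j ν → Through τ t G p μ → (∀ {ξ} → p ∋ ξ → q ∋ ξ ∙ ν) →
             Through τ t (gate times i j G) q (μ ∙ ν)
  multiply {q = q} i j ν T p·ν⊆q = record
    { at = suc at ; inner = inner ; outer = outer ∙ ν ; produces = produces
    ; heavy = heavy ; light = light
    ; factors = trans (cong (_∙ ν) factors) (∙-assoc inner outer ν)
    ; replace = λ {ξ} h → subst (q ∋_) (∙-assoc ξ outer ν) (p·ν⊆q (replace h)) }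
    where open Through T

  -- Walk down while the weight is at least 2t: at a sum into the summand producing μ, at a product
  -- into a factor of weight at least t, which exists by subadditivity. Inputs weigh less than t, so
  -- the walk stops at a gate.
  descend : ∀ (G : Gates n s) i {μ} → lookup (nodes G) i ∋ μ → t ≤ τ μ →
            Through τ t G (lookup (nodes G) i) μ
  descend inputs i h t≤ rewrite lookup∘tabulate var i = contradiction t≤ (<⇒≱ (τ-var i h))
  descend (gate o i j G) (suc k) h t≤ = weaken o i j (descend G k h t≤) id
  descend (gate o i j G) zero {μ} h t≤ with τ μ <? 2 * t
  ... | yes lt = record
    { at = zero ; inner = μ ; outer = one ; produces = h ; heavy = t≤ ; light = lt
    ; factors = sym (∙-identityʳ μ)
    ; replace = λ {ν} → subst (⟦ o ⟧ (lookup (nodes G) i) (lookup (nodes G) j) ∋_) (sym (∙-identityʳ ν)) }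
  descend (gate plus i j G) zero h t≤ | no _ with ⊕∋⁻ (lookup (nodes G) i) (lookup (nodes G) j) h
  ... | inj₁ h₁ = weaken plus i j (descend G i h₁ t≤) (⊕∋⁺ˡ (lookup (nodes G) i) _)
  ... | inj₂ h₂ = weaken plus i j (descend G j h₂ t≤) (⊕∋⁺ʳ (lookup (nodes G) i) _)
  descend (gate times i j G) zero h t≤ | no ≮2t with ⊗∋⁻ (lookup (nodes G) i) (lookup (nodes G) j) h
  ... | μ , ν , h₁ , h₂ , refl with t ≤? τ μ
  ...   | yes t≤μ = multiply i j ν (descend G i h₁ t≤μ) λ k → ⊗∋⁺ (lookup (nodes G) i) _ k h₂
  -- `multiply` puts the cofactor on the right, so descending into the second factor takes
  -- commutativity.
  ...   | no  t≰μ = subst (Through τ t _ _) (∙-comm ν μ)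
    (multiply i j μ (descend G j h₂ t≤ν) λ {ξ} k →
      subst (lookup (nodes G) i ⊗ lookup (nodes G) j ∋_) (∙-comm μ ξ) (⊗∋⁺ (lookup (nodes G) i) _ h₁ k))
    where
    t≤ν : t ≤ τ ν
    t≤ν = ≮⇒≥ λ ν<t → ≮2t (≤-<-trans (τ-∙ μ ν)
      (<-≤-trans (+-mono-< (≰⇒> t≰μ) ν<t) (≤-reflexive (cong (t +_) (sym (+-identityʳ t))))))

-- The lower bound

toSubset : ∀ {P : Fin m → Set} → Decidable P → Subset m
toSubset P? = Vec.tabulate (does ∘ P?)

∈-toSubset⁺ : ∀ {P : Fin m → Set} (P? : Decidable P) {i} → P i → i ∈ˢ toSubset P?
∈-toSubset⁺ P? {i} p = lookup⇒[]= i _ (trans (lookup∘tabulate _ i) (dec-true (P? i) p))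

∈-toSubset⁻ : ∀ {P : Fin m → Set} (P? : Decidable P) {i} → i ∈ˢ toSubset P? → P i
∈-toSubset⁻ P? {i} i∈ with P? i | trans (sym (lookup∘tabulate (does ∘ P?) i)) ([]=⇒lookup i∈)
... | yes p | _ = p

∣p∪q∣≤∣p∣+∣q∣ : (p q : Subset m) → ∣ p ∪ q ∣ ≤ ∣ p ∣ + ∣ q ∣
∣p∪q∣≤∣p∣+∣q∣ []            []            = z≤n
∣p∪q∣≤∣p∣+∣q∣ (inside  ∷ p) (inside  ∷ q) =
  s≤s (≤-trans (∣p∪q∣≤∣p∣+∣q∣ p q) (+-monoʳ-≤ ∣ p ∣ (n≤1+n _)))
∣p∪q∣≤∣p∣+∣q∣ (inside  ∷ p) (outside ∷ q) = s≤s (∣p∪q∣≤∣p∣+∣q∣ p q)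
∣p∪q∣≤∣p∣+∣q∣ (outside ∷ p) (inside  ∷ q) =
  ≤-trans (s≤s (∣p∪q∣≤∣p∣+∣q∣ p q)) (≤-reflexive (sym (+-suc ∣ p ∣ ∣ q ∣)))
∣p∪q∣≤∣p∣+∣q∣ (outside ∷ p) (outside ∷ q) = ∣p∪q∣≤∣p∣+∣q∣ p q

decideBool : {P : Bool → Set} → Decidable P → Dec (∃ P)
decideBool P? = map′ (λ { (inj₁ p) → false , p ; (inj₂ p) → true , p })
                     (λ { (false , p) → inj₁ p ; (true , p) → inj₂ p })
                     (P? false ⊎-dec P? true)

_at_ : Monomial n → Fin n → Set
μ at v = lookup μ v ≢ 0

at-∙⁻ : ∀ (μ ν : Monomial n) v → (μ ∙ ν) at v → μ at v ⊎ ν at v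
at-∙⁻ μ ν v h with lookup μ v ≟ 0
... | no μv≢0  = inj₁ μv≢0
... | yes μv≡0 = inj₂ λ νv≡0 → h (trans (lookup-∙ μ ν v) (cong₂ _+_ μv≡0 νv≡0))

at-∙⁺ˡ : ∀ (μ ν : Monomial n) v → μ at v → (μ ∙ ν) at v
at-∙⁺ˡ μ ν v h eq = h (m+n≡0⇒m≡0 _ (trans (sym (lookup-∙ μ ν v)) eq))

at-∙⁺ʳ : ∀ (μ ν : Monomial n) v → ν at v → (μ ∙ ν) at v
at-∙⁺ʳ μ ν v h eq = h (m+n≡0⇒n≡0 (lookup μ v) (trans (sym (lookup-∙ μ ν v)) eq))

var-at : ∀ (i : Fin n) {μ v} → var i ∋ μ → μ at v → i ≡ v
var-at i {v = v} (_ , here refl) h with i Fin.≟ v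
... | yes eq = eq
... | no ne  = contradiction (trans (lookup∘tabulate _ v) (cong bit (dec-false (i Fin.≟ v) ne))) h

-- Only cell variables are constrained. The marks, in which the two envelopes differ, stay free, so
-- one lower bound serves both.
Encodes : (Fin m → Fin m → Bool → Bool → Fin n) → Monomial n → (Fin m → Bool) → (Fin m → Bool) → Set
Encodes cell μ x y =
  (∀ i j c d → μ at cell i j c d → c ≡ x i × d ≡ y j) × (∀ i j → μ at cell i j (x i) (y j))

module Hardness (cell : Fin m → Fin m → Bool → Bool → Fin n)
  (cell-injectiveˡ : ∀ {i j c d i′ j′ c′ d′} → cell i j c d ≡ cell i′ j′ c′ d′ → i ≡ i′) where

  -- The diagonal is what gets weighed: in a term with y = x, the variable of cell (i , i) reveals
  -- the bit `x i` both as a row bit and as a column bit.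
  Touches : Monomial n → Fin m → Set
  Touches μ i = ∃[ c ] ∃[ d ] μ at cell i i c d

  touches? : ∀ μ → Decidable (Touches μ)
  touches? μ i = decideBool λ c → decideBool λ d → ¬? (lookup μ (cell i i c d) ≟ 0)

  touched : Monomial n → Subset m
  touched μ = toSubset (touches? μ)

  touched-∙ : ∀ μ ν → ∣ touched (μ ∙ ν) ∣ ≤ ∣ touched μ ∣ + ∣ touched ν ∣
  touched-∙ μ ν = ≤-trans (p⊆q⇒∣p∣≤∣q∣ μν⊆) (∣p∪q∣≤∣p∣+∣q∣ (touched μ) (touched ν))
    where
    μν⊆ : touched (μ ∙ ν) ⊆ touched μ ∪ touched ν
    μν⊆ i∈ with ∈-toSubset⁻ (touches? (μ ∙ ν)) i∈
    ... | c , d , h with at-∙⁻ μ ν _ h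
    ...   | inj₁ hμ = x∈p∪q⁺ (inj₁ (∈-toSubset⁺ (touches? μ) (c , d , hμ)))
    ...   | inj₂ hν = x∈p∪q⁺ (inj₂ (∈-toSubset⁺ (touches? ν) (c , d , hν)))

  touched-var : ∀ i {μ} → var i ∋ μ → ∣ touched μ ∣ ≤ 1
  touched-var i {μ} h with Fin.any? (touches? μ)
  ... | yes (k , c , d , hk) = ≤-trans (p⊆q⇒∣p∣≤∣q∣ μ⊆k) (≤-reflexive (∣⁅x⁆∣≡1 k))
    where
    μ⊆k : touched μ ⊆ ⁅ k ⁆
    μ⊆k l∈ with ∈-toSubset⁻ (touches? μ) l∈
    ... | c′ , d′ , hl with cell-injectiveˡ (trans (sym (var-at i h hk)) (var-at i h hl))
    ...   | refl = x∈⁅x⁆ k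
  ... | no ¬touch = ≤-trans (p⊆q⇒∣p∣≤∣q∣ {q = ⊥} λ l∈ → contradiction (_ , ∈-toSubset⁻ (touches? μ) l∈) ¬touch)
                            (≤-trans (≤-reflexive (∣⊥∣≡0 m)) z≤n)

  touched-encoding : ∀ {μ x y} → Encodes cell μ x y → m ≤ ∣ touched μ ∣
  touched-encoding {μ} (_ , full) = ≤-trans (≤-reflexive (sym (∣⊤∣≡n m)))
    (p⊆q⇒∣p∣≤∣q∣ {p = ⊤} λ {i} _ → ∈-toSubset⁺ (touches? μ) (_ , _ , full i i))

  module Rectangles (C : Circuit n)
    (sound : ∀ {μ} → produced C ∋ μ → ∃₂ λ x y → Encodes cell μ x y)
    (complete : ∀ x → ∃[ μ ] produced C ∋ μ × Encodes cell μ x x)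
    (t : ℕ) (2≤t : 2 ≤ t) (3t≤m : 3 * t ≤ m) where

    -- A variable touches at most one diagonal cell, so t ≥ 2 keeps the descent from reaching an
    -- input.
    open Descent (∣_∣ ∘ touched) t touched-∙ (λ i k → <-≤-trans (s≤s (touched-var i k)) 2≤t)

    ThroughGates : Monomial n → Set
    ThroughGates = Through (∣_∣ ∘ touched) t (gates C) (produced C)

    -- Since inner and outer parts at the same gate can be recombined, the cell
    -- (i , j) of the second monomial occurs in an encoding that agrees with the
    -- first one at xᵢ (if it lies in the outer part) or at xⱼ (in the inner part).
    recombine : ∀ {μ ν x y} (S : ThroughGates μ) (T : ThroughGates ν) →
                Encodes cell μ x x → Encodes cell ν y y → Through.at S ≡ Through.at T →
                ∀ i j → i ∈ˢ touched (Through.inner S) → j ∉ touched (Through.inner S) →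
                y i ≡ x i ⊎ y j ≡ x j
    recombine {μ} {ν} {x} {y} S T (only-μ , full-μ) (_ , full-ν) same i j i∈ j∉ =
      [ inj₂ ∘ in-inner , inj₁ ∘ in-outer ]′ (at-∙⁻ A B _ (subst (_at _) T.factors (full-ν i j)))
      where
      module S = Through S
      module T = Through T
      A₀ = S.inner
      B₀ = S.outer
      A  = T.inner
      B  = T.outer
      in-outer : B at cell i j (y i) (y j) → y i ≡ x i
      in-outer ij∈B
        with sound (T.replace (subst (λ g → gatePoly (gates C) g ∋ A₀) same S.produces))
           | ∈-toSubset⁻ (touches? A₀) i∈
      ... | u , v , only , _ | c , d , ii∈A₀ = begin
        y i  ≡⟨ proj₁ (only i j _ _ (at-∙⁺ʳ A₀ B _ ij∈B)) ⟩
        u i  ≡⟨ proj₁ (only i i c d (at-∙⁺ˡ A₀ B _ ii∈A₀)) ⟨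
        c    ≡⟨ proj₁ (only-μ i i c d (subst (_at _) (sym S.factors) (at-∙⁺ˡ A₀ B₀ _ ii∈A₀))) ⟩
        x i  ∎
        where open ≡-Reasoning
      -- The other exchange: `A ∙ B₀` is produced, and the cell (j , j) of μ lies in `B₀` because
      -- `A₀` does not touch j.
      in-inner : A at cell i j (y i) (y j) → y j ≡ x j
      in-inner ij∈A
        with sound (S.replace (subst (λ g → gatePoly (gates C) g ∋ A) (sym same) T.produces))
           | at-∙⁻ A₀ B₀ _ (subst (_at _) S.factors (full-μ j j))
      ... | _ | inj₁ jj∈A₀ = contradiction (∈-toSubset⁺ (touches? A₀) (_ , _ , jj∈A₀)) j∉
      ... | u , v , only , _ | inj₂ jj∈B₀ =
        trans (proj₂ (only i j _ _ (at-∙⁺ˡ A B₀ _ ij∈A))) (sym (proj₂ (only j j _ _ (at-∙⁺ʳ A B₀ _ jj∈B₀))))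

    -- Fewer than 2t of at least 3t diagonal indices are touched.
    co-heavy : ∀ {μ} (S : ThroughGates μ) → t ≤ ∣ ∁ (touched (Through.inner S)) ∣
    co-heavy S = begin
      t                          ≡⟨ m+n∸n≡m t (2 * t) ⟨
      3 * t ∸ 2 * t              ≤⟨ ∸-mono 3t≤m (<⇒≤ light) ⟩
      m ∸ ∣ touched inner ∣      ≡⟨ ∣∁p∣≡n∸∣p∣ (touched inner) ⟨
      ∣ ∁ (touched inner) ∣      ∎
      where
      open ≤-Reasoning
      open Through S

    encoding : ∀ (x : Vec Bool m) → ∃[ μ ] ThroughGates μ × Encodes cell μ (lookup x) (lookup x)
    encoding x with complete (lookup x)
    ... | μ , k , enc = μ , descend (gates C) (output C) k (≤-trans (m≤n*m t 3) (≤-trans 3t≤m (touched-encoding {μ} enc))) , enc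

    size-bound : 2 ^ t ≤ size C * 2
    size-bound = cover t (λ x → Through.at (through x)) (λ x → touched (Through.inner (through x)))
      (λ x → Through.heavy (through x)) (λ x → co-heavy (through x))
      (λ x y → recombine (through x) (through y) (proj₂ (proj₂ (encoding x))) (proj₂ (proj₂ (encoding y))))
      where
      through : ∀ x → ThroughGates (proj₁ (encoding x))
      through x = proj₁ (proj₂ (encoding x))

  -- `Encodes` depends only on which variables occur, and up to exponents a circuit counting h
  -- produces the monomials of h. So soundness and completeness pass from h to the circuit.
  hard : (h : Polynomial n) → Positive h →
         (∀ {μ} → h ∋ μ → ∃₂ λ x y → Encodes cell μ x y) →
         (∀ x → ∃[ μ ] h ∋ μ × Encodes cell μ x x) →
         ∀ t → 2 ≤ t → 3 * t ≤ m → ∀ C → C Counts h → 2 ^ t ≤ size C * 2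
  hard h positive sound complete t 2≤t 3t≤m C counts = Rectangles.size-bound C sound′ complete′ t 2≤t 3t≤m
    where
    encodes-clip : ∀ {μ ν x y} → clip μ ≡ clip ν → Encodes cell ν x y → Encodes cell μ x y
    encodes-clip {μ} {ν} eq (only , full) =
      (λ i j c d → only i j c d ∘ clip-nonzero {μ = μ} {ν} eq _) , λ i j → clip-nonzero {μ = ν} {μ} (sym eq) _ (full i j)
    sound′ : ∀ {μ} → produced C ∋ μ → ∃₂ λ x y → Encodes cell μ x y
    sound′ k with sameSupports (produced C) h counts (positive-nodes (gates C) (output C)) k
    ... | ν , h∋ν , eq with sound h∋ν
    ...   | x , y , enc = x , y , encodes-clip eq enc
    complete′ : ∀ x → ∃[ μ ] produced C ∋ μ × Encodes cell μ x x
    complete′ x with complete x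
    ... | ν , h∋ν , enc with sameSupports h (produced C) (sym ∘ counts) positive h∋ν
    ...   | μ , k , eq = μ , k , encodes-clip (sym eq) enc

-- Products of families of formulas and monomials

-- The family is nonempty because formulas have no constants to start from.
fold : Op → (Fin (suc k) → Formula n) → Formula n
fold {zero}  o e = e zero
fold {suc k} o e = node o (e zero) (fold o (e ∘ suc))

∏ : (Fin (suc k) → Monomial n) → Monomial n
∏ {zero}  ν = ν zero
∏ {suc k} ν = ν zero ∙ ∏ (ν ∘ suc)

leaves-fold : ∀ o (e : Fin (suc k) → Formula n) l → (∀ i → leaves (e i) ≡ l) → leaves (fold o e) ≡ suc k * l
leaves-fold {zero}  o e l eq = trans (eq zero) (sym (*-identityˡ l))
leaves-fold {suc k} o e l eq = cong₂ _+_ (eq zero) (leaves-fold o (e ∘ suc) l (eq ∘ suc))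

fold∋⁺ : ∀ (e : Fin (suc k) → Formula n) (ν : Fin (suc k) → Monomial n) →
         (∀ i → poly (e i) ∋ ν i) → poly (fold times e) ∋ ∏ ν
fold∋⁺ {zero}  e ν h = h zero
fold∋⁺ {suc k} e ν h = ⊗∋⁺ (poly (e zero)) _ (h zero) (fold∋⁺ (e ∘ suc) (ν ∘ suc) (h ∘ suc))

fold∋⁻ : ∀ {A : Set} (e : Fin (suc k) → Formula n) (ν : Fin (suc k) → A → Monomial n) →
         (∀ i {μ} → poly (e i) ∋ μ → ∃[ a ] μ ≡ ν i a) →
         ∀ {μ} → poly (fold times e) ∋ μ → Σ (Fin (suc k) → A) λ a → μ ≡ ∏ (λ i → ν i (a i))
fold∋⁻ {zero} e ν h p with h zero p
... | a , eq = (λ _ → a) , eq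
fold∋⁻ {suc k} {A = A} e ν h p with ⊗∋⁻ (poly (e zero)) _ p
... | _ , _ , p₁ , p₂ , refl with h zero p₁ | fold∋⁻ (e ∘ suc) (ν ∘ suc) (h ∘ suc) p₂
... | a , refl | as , refl = cons , refl
  where
  cons : Fin (suc (suc k)) → A
  cons zero    = a
  cons (suc i) = as i

∏-at⁺ : ∀ (ν : Fin (suc k) → Monomial n) {v} i → ν i at v → ∏ ν at v
∏-at⁺ {zero}  ν zero    h = h
∏-at⁺ {suc k} ν zero    h = at-∙⁺ˡ (ν zero) _ _ h
∏-at⁺ {suc k} ν (suc i) h = at-∙⁺ʳ (ν zero) _ _ (∏-at⁺ (ν ∘ suc) i h)

∏-at⁻ : ∀ (ν : Fin (suc k) → Monomial n) {v} → ∏ ν at v → ∃[ i ] ν i at v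
∏-at⁻ {zero}  ν h = zero , h
∏-at⁻ {suc k} ν h with at-∙⁻ (ν zero) _ _ h
... | inj₁ h₁ = zero , h₁
... | inj₂ h₂ with ∏-at⁻ (ν ∘ suc) h₂
...   | i , hᵢ = suc i , hᵢ

SquareFree : Monomial n → Set
SquareFree μ = ∀ v → lookup μ v ≤ 1

∙-squareFree : ∀ (μ ν : Monomial n) → SquareFree μ → SquareFree ν →
               (∀ v → μ at v → ¬ ν at v) → SquareFree (μ ∙ ν)
∙-squareFree μ ν μ≤1 ν≤1 disjoint v rewrite lookup-∙ μ ν v with lookup μ v ≟ 0
... | yes μv≡0 rewrite μv≡0 = ν≤1 v
... | no μv≢0 with lookup ν v ≟ 0
...   | yes νv≡0 rewrite νv≡0 | +-identityʳ (lookup μ v) = μ≤1 v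
...   | no νv≢0 = contradiction νv≢0 (disjoint v μv≢0)

∏-squareFree : ∀ (ν : Fin (suc k) → Monomial n) → (∀ i → SquareFree (ν i)) →
               (∀ {v} i j → ν i at v → ν j at v → i ≡ j) → SquareFree (∏ ν)
∏-squareFree {zero}  ν ν≤1 disjoint = ν≤1 zero
∏-squareFree {suc k} ν ν≤1 disjoint = ∙-squareFree (ν zero) _ (ν≤1 zero)
  (∏-squareFree (ν ∘ suc) (ν≤1 ∘ suc) (λ i j p q → Fin.suc-injective (disjoint (suc i) (suc j) p q)))
  λ v p q → let j , r = ∏-at⁻ (ν ∘ suc) q in Fin.0≢1+n (disjoint zero (suc j) p r)

unit : Fin n → Monomial n
unit i = Vec.tabulate λ j → bit (does (i Fin.≟ j))

unit-at⁺ : ∀ (i : Fin n) → unit i at i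
unit-at⁺ i eq with trans (sym eq) (trans (lookup∘tabulate _ i) (cong bit (dec-true (i Fin.≟ i) refl)))
... | ()

unit-at⁻ : ∀ (i : Fin n) {v} → unit i at v → i ≡ v
unit-at⁻ i = var-at i (1 , here refl)

unit-squareFree : ∀ (i : Fin n) → SquareFree (unit i)
unit-squareFree i v rewrite lookup∘tabulate (λ j → bit (does (i Fin.≟ j))) v with does (i Fin.≟ v)
... | false = z≤n
... | true  = s≤s z≤n

var∋⁺ : ∀ (i : Fin n) → var i ∋ unit i
var∋⁺ i = 1 , here refl

var∋⁻ : ∀ (i : Fin n) {μ} → var i ∋ μ → μ ≡ unit i
var∋⁻ i (_ , here refl) = refl

-- Degrees

degree-unit : ∀ (i : Fin n) → degree (unit i) ≡ 1
degree-unit {suc n} zero    = cong suc (zeros n)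
  where
  zeros : ∀ n → Vec.sum (Vec.tabulate {n = n} λ _ → 0) ≡ 0
  zeros zero    = refl
  zeros (suc n) = zeros n
degree-unit {suc n} (suc i) = degree-unit i

-- A record, so that `e` can be inferred from the type, which unfolding `poly e` would prevent.
record Homogeneous (d : ℕ) (e : Formula n) : Set where
  constructor homogeneous
  field degree≡ : ∀ {μ} → poly e ∋ μ → degree μ ≡ d

open Homogeneous

homogeneous-leaf : ∀ {i : Fin n} → Homogeneous 1 (leaf i)
homogeneous-leaf {i = i} = homogeneous λ h → trans (cong degree (var∋⁻ i h)) (degree-unit i)

homogeneous-plus : ∀ {d} {e e′ : Formula n} → Homogeneous d e → Homogeneous d e′ → Homogeneous d (node plus e e′)
homogeneous-plus {e = e} {e′} H H′ = homogeneous λ h → [ degree≡ H , degree≡ H′ ]′ (⊕∋⁻ (poly e) (poly e′) h)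

homogeneous-times : ∀ {d d′} {e e′ : Formula n} → Homogeneous d e → Homogeneous d′ e′ →
                    Homogeneous (d + d′) (node times e e′)
homogeneous-times {d = d} {d′} {e} {e′} H H′ = homogeneous λ h → product (⊗∋⁻ (poly e) (poly e′) h)
  where
  product : ∀ {ξ} → (∃₂ λ μ ν → poly e ∋ μ × poly e′ ∋ ν × ξ ≡ μ ∙ ν) → degree ξ ≡ d + d′
  product (μ , ν , h₁ , h₂ , refl) = trans (degree-∙ μ ν) (cong₂ _+_ (degree≡ H h₁) (degree≡ H′ h₂))

homogeneous-fold : ∀ {d} {e : Fin (suc k) → Formula n} → (∀ i → Homogeneous d (e i)) →
                   Homogeneous (suc k * d) (fold times e)
homogeneous-fold {zero}  {e = e} H = homogeneous λ h → trans (degree≡ (H zero) h) (sym (+-identityʳ _))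
homogeneous-fold {suc k} {e = e} H = homogeneous-times (H zero) (homogeneous-fold (H ∘ suc))

degree-mono : ∀ (μ ν : Monomial n) → (∀ v → lookup μ v ≤ lookup ν v) → degree μ ≤ degree ν
degree-mono []      []      h = z≤n
degree-mono (d ∷ μ) (e ∷ ν) h = +-mono-≤ (h zero) (degree-mono μ ν (h ∘ suc))

-- A gap at one coordinate would make the degree of ν strictly larger.
degree-tight : ∀ (μ ν : Monomial n) → (∀ v → lookup μ v ≤ lookup ν v) → degree ν ≤ degree μ →
               ∀ v → lookup ν v ≤ lookup μ v
degree-tight (d ∷ μ) (e ∷ ν) h le zero    =
  +-cancelʳ-≤ (degree μ) e d (≤-trans (+-monoʳ-≤ e (degree-mono μ ν (h ∘ suc))) le)
degree-tight (d ∷ μ) (e ∷ ν) h le (suc v) = degree-tight μ ν (h ∘ suc)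
  (+-cancelˡ-≤ d _ _ (≤-trans (+-monoˡ-≤ (degree ν) (h zero)) le)) v

squareFree⇒degree-clip : ∀ (μ : Monomial n) → SquareFree μ → degree μ ≤ degree (clip μ)
squareFree⇒degree-clip μ μ≤1 = degree-mono μ (clip μ) λ v →
  ≤-trans (⊓-glb (μ≤1 v) ≤-refl) (≤-reflexive (sym (lookup-map v _ μ)))

clip-≤ : ∀ (μ : Monomial n) v → lookup (clip μ) v ≤ lookup μ v
clip-≤ μ v = ≤-trans (≤-reflexive (lookup-map v _ μ)) (m⊓n≤n 1 _)

-- Clipping an exponent above 1 would lower the degree.
degree-clip⇒squareFree : ∀ (μ : Monomial n) → degree μ ≤ degree (clip μ) → SquareFree μ
degree-clip⇒squareFree μ le v = ≤-trans (degree-tight (clip μ) μ (clip-≤ μ) le v)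
  (≤-trans (≤-reflexive (lookup-map v _ μ)) (m⊓n≤m 1 _))

squareFree-≤-clip : ∀ (μ ν : Monomial n) → SquareFree μ → ∀ v → lookup μ v ≤ lookup (clip (μ ∙ ν)) v
squareFree-≤-clip μ ν μ≤1 v rewrite lookup-map v (1 ⊓_) (μ ∙ ν) | lookup-∙ μ ν v = ⊓-glb (μ≤1 v) (m≤m+n _ _)

at-clip⁻ : ∀ (μ : Monomial n) {v} → clip μ at v → μ at v
at-clip⁻ μ {v} h eq = h (trans (lookup-map v _ μ) (cong (1 ⊓_) eq))

at-clip⁺ : ∀ (μ : Monomial n) {v} → μ at v → clip μ at v
at-clip⁺ μ {v} h eq with lookup μ v | lookup-map v (1 ⊓_) μ
... | zero  | _   = h refl
... | suc _ | eq′ = contradiction (trans (sym eq) eq′) λ ()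

-- `clip (μ ∙ ν)` is the product of all variables of μ or ν, so its degree exceeds that of a
-- square-free μ as soon as ν brings in a new variable.
degree-clip-∙⇒⊆ : ∀ (μ ν : Monomial n) → SquareFree μ → degree (clip (μ ∙ ν)) ≤ degree μ →
                  ∀ {v} → ν at v → μ at v
degree-clip-∙⇒⊆ μ ν μ≤1 le {v} νv μv≡0 = at-clip⁺ (μ ∙ ν) (at-∙⁺ʳ μ ν v νv)
  (n≤0⇒n≡0 (≤-trans (degree-tight μ (clip (μ ∙ ν)) (squareFree-≤-clip μ ν μ≤1) le v) (≤-reflexive μv≡0)))

⊆⇒degree-clip-∙ : ∀ (μ ν : Monomial n) → (∀ {v} → ν at v → μ at v) → degree (clip (μ ∙ ν)) ≤ degree μ
⊆⇒degree-clip-∙ μ ν ν⊆μ = degree-mono (clip (μ ∙ ν)) μ pointwise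
  where
  pointwise : ∀ v → lookup (clip (μ ∙ ν)) v ≤ lookup μ v
  pointwise v with lookup μ v ≟ 0
  ... | no μv≢0 = ≤-trans (≤-reflexive (lookup-map v _ (μ ∙ ν))) (≤-trans (m⊓n≤m 1 _) (n≢0⇒n>0 μv≢0))
  ... | yes μv≡0 with lookup ν v ≟ 0
  ...   | no νv≢0  = contradiction μv≡0 (ν⊆μ νv≢0)
  ...   | yes νv≡0 = ≤-trans (clip-≤ (μ ∙ ν) v)
    (≤-trans (≤-reflexive (trans (lookup-∙ μ ν v) (trans (cong (lookup μ v +_) νv≡0) (+-identityʳ _)))) ≤-refl)

-- The grid polynomial and its envelopes

-- `cell i j c d` is t(i,j,c,d) and `mark i j d` is v(i,j,d). The names need not exhaust the n
-- variables, so a grid fits into every n ≥ 6m².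
record Names (m n : ℕ) : Set where
  field
    cell           : Fin m → Fin m → Bool → Bool → Fin n
    mark           : Fin m → Fin m → Bool → Fin n
    cell-injective : ∀ {i j c d i′ j′ c′ d′} → cell i j c d ≡ cell i′ j′ c′ d′ →
                     (i ≡ i′ × j ≡ j′) × (c ≡ c′ × d ≡ d′)
    mark-injective : ∀ {i j d i′ j′ d′} → mark i j d ≡ mark i′ j′ d′ → (i ≡ i′ × j ≡ j′) × d ≡ d′
    cell≢mark      : ∀ {i j c d i′ j′ d′} → cell i j c d ≢ mark i′ j′ d′

module Grid {k n} (names : Names (suc k) n) where
  open Names names

  m′ : ℕ
  m′ = suc k

  Choice : Set
  Choice = Fin m′ → Bool

  cellFormula : Fin m′ → Bool → Fin m′ → Bool → Formula n
  cellFormula i c j d = node times (leaf (cell i j c d)) (leaf (mark i j d))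

  rowFormula : Fin m′ → Bool → Formula n
  rowFormula i c = fold times λ j → node plus (cellFormula i c j false) (cellFormula i c j true)

  rows : Formula n
  rows = fold times λ i → node plus (rowFormula i false) (rowFormula i true)

  columnFormula : Fin m′ → Bool → Formula n
  columnFormula j d = fold times λ i → leaf (mark i j d)

  columns : Formula n
  columns = fold times λ j → node plus (columnFormula j false) (columnFormula j true)

  grid : Formula n
  grid = node times rows columns

  f : Polynomial n
  f = multilinearize (poly grid)

  choose⁻ : ∀ (e : Bool → Formula n) {μ} → poly (node plus (e false) (e true)) ∋ μ → ∃[ b ] poly (e b) ∋ μ
  choose⁻ e h = [ false ,_ , true ,_ ]′ (⊕∋⁻ (poly (e false)) (poly (e true)) h)

  choose⁺ : ∀ (e : Bool → Formula n) b {μ} → poly (e b) ∋ μ → poly (node plus (e false) (e true)) ∋ μ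
  choose⁺ e false h = ⊕∋⁺ˡ (poly (e false)) _ h
  choose⁺ e true  h = ⊕∋⁺ʳ (poly (e false)) _ h

  cellM : Fin m′ → Bool → Fin m′ → Bool → Monomial n
  cellM i c j d = unit (cell i j c d) ∙ unit (mark i j d)

  rowM : Fin m′ → Bool × Choice → Monomial n
  rowM i (c , D) = ∏ λ j → cellM i c j (D j)

  rowsM : (Fin m′ → Bool × Choice) → Monomial n
  rowsM X = ∏ λ i → rowM i (X i)

  columnM : Fin m′ → Bool → Monomial n
  columnM j d = ∏ λ i → unit (mark i j d)

  columnsM : Choice → Monomial n
  columnsM y = ∏ λ j → columnM j (y j)

  cell∋⁻ : ∀ i c j d {μ} → poly (cellFormula i c j d) ∋ μ → μ ≡ cellM i c j d
  cell∋⁻ i c j d h with ⊗∋⁻ (var (cell i j c d)) (var (mark i j d)) h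
  ... | _ , _ , h₁ , h₂ , refl = cong₂ _∙_ (var∋⁻ (cell i j c d) h₁) (var∋⁻ (mark i j d) h₂)

  row∋⁻ : ∀ i c {μ} → poly (rowFormula i c) ∋ μ → ∃[ D ] μ ≡ rowM i (c , D)
  row∋⁻ i c = fold∋⁻ _ (cellM i c) λ j h → let d , h′ = choose⁻ (cellFormula i c j) h in d , cell∋⁻ i c j d h′

  rows∋⁻ : ∀ {μ} → poly rows ∋ μ → ∃[ X ] μ ≡ rowsM X
  rows∋⁻ = fold∋⁻ _ rowM λ i h →
    let c , h′ = choose⁻ (rowFormula i) h
        D , eq = row∋⁻ i c h′
    in (c , D) , eq

  cell∋⁺ : ∀ i c j d → poly (cellFormula i c j d) ∋ cellM i c j d
  cell∋⁺ i c j d = ⊗∋⁺ (var (cell i j c d)) (var (mark i j d)) (var∋⁺ (cell i j c d)) (var∋⁺ (mark i j d))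

  row∋⁺ : ∀ i X → poly (rowFormula i (proj₁ X)) ∋ rowM i X
  row∋⁺ i (c , D) = fold∋⁺ (λ j → node plus (cellFormula i c j false) (cellFormula i c j true)) (λ j → cellM i c j (D j))
    λ j → choose⁺ (cellFormula i c j) (D j) (cell∋⁺ i c j (D j))

  rows∋⁺ : ∀ X → poly rows ∋ rowsM X
  rows∋⁺ X = fold∋⁺ (λ i → node plus (rowFormula i false) (rowFormula i true)) (λ i → rowM i (X i))
    λ i → choose⁺ (rowFormula i) (proj₁ (X i)) (row∋⁺ i (X i))

  columns∋⁻ : ∀ {μ} → poly columns ∋ μ → ∃[ y ] μ ≡ columnsM y
  columns∋⁻ = fold∋⁻ _ columnM λ j h →
    let d , h′ = choose⁻ (columnFormula j) h
    in d , proj₂ (fold∋⁻ _ (λ i _ → unit (mark i j d)) (λ i h″ → d , var∋⁻ (mark i j d) h″) h′)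

  column∋⁺ : ∀ j d → poly (columnFormula j d) ∋ columnM j d
  column∋⁺ j d = fold∋⁺ (λ i → leaf (mark i j d)) (λ i → unit (mark i j d)) λ i → var∋⁺ (mark i j d)

  columns∋⁺ : ∀ y → poly columns ∋ columnsM y
  columns∋⁺ y = fold∋⁺ (λ j → node plus (columnFormula j false) (columnFormula j true)) (λ j → columnM j (y j))
    λ j → choose⁺ (columnFormula j) (y j) (column∋⁺ j (y j))

  data InRows (X : Fin m′ → Bool × Choice) : Fin n → Set where
    in-cell : ∀ i j → InRows X (cell i j (proj₁ (X i)) (proj₂ (X i) j))
    in-mark : ∀ i j → InRows X (mark i j (proj₂ (X i) j))

  cellM-at⁻ : ∀ i c j d {v} → cellM i c j d at v → v ≡ cell i j c d ⊎ v ≡ mark i j d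
  cellM-at⁻ i c j d h with at-∙⁻ (unit (cell i j c d)) _ _ h
  ... | inj₁ h₁ = inj₁ (sym (unit-at⁻ _ h₁))
  ... | inj₂ h₂ = inj₂ (sym (unit-at⁻ _ h₂))

  rowsM-at⁻ : ∀ X {v} → rowsM X at v → InRows X v
  rowsM-at⁻ X h with ∏-at⁻ (λ i → rowM i (X i)) h
  ... | i , h₁ with ∏-at⁻ (λ j → cellM i (proj₁ (X i)) j (proj₂ (X i) j)) h₁
  ...   | j , h₂ with cellM-at⁻ i (proj₁ (X i)) j (proj₂ (X i) j) h₂
  ...     | inj₁ refl = in-cell i j
  ...     | inj₂ refl = in-mark i j

  rowsM-at⁺ : ∀ X {v} → InRows X v → rowsM X at v
  rowsM-at⁺ X (in-cell i j) = ∏-at⁺ (λ i → rowM i (X i)) i (∏-at⁺ (λ j → cellM i (proj₁ (X i)) j (proj₂ (X i) j)) j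
    (at-∙⁺ˡ (unit (cell i j (proj₁ (X i)) (proj₂ (X i) j))) _ _ (unit-at⁺ (cell i j (proj₁ (X i)) (proj₂ (X i) j)))))
  rowsM-at⁺ X (in-mark i j) = ∏-at⁺ (λ i → rowM i (X i)) i (∏-at⁺ (λ j → cellM i (proj₁ (X i)) j (proj₂ (X i) j)) j
    (at-∙⁺ʳ (unit (cell i j (proj₁ (X i)) (proj₂ (X i) j))) _ _ (unit-at⁺ (mark i j (proj₂ (X i) j)))))

  columnM-at⁻ : ∀ j d {v} → columnM j d at v → ∃[ i ] v ≡ mark i j d
  columnM-at⁻ j d h with ∏-at⁻ (λ i → unit (mark i j d)) h
  ... | i , h₁ = i , sym (unit-at⁻ _ h₁)

  columnsM-at⁻ : ∀ y {v} → columnsM y at v → ∃₂ λ i j → v ≡ mark i j (y j)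
  columnsM-at⁻ y h with ∏-at⁻ (λ j → columnM j (y j)) h
  ... | j , h₁ with columnM-at⁻ j (y j) h₁
  ...   | i , eq = i , j , eq

  columnsM-at⁺ : ∀ y i j → columnsM y at mark i j (y j)
  columnsM-at⁺ y i j = ∏-at⁺ (λ j → columnM j (y j)) j (∏-at⁺ (λ i → unit (mark i j (y j))) i (unit-at⁺ (mark i j (y j))))

  -- Distinct positions carry distinct variables. Hence a variable can only repeat between the row
  -- part and the column part.
  rowsM-squareFree : ∀ X → SquareFree (rowsM X)
  rowsM-squareFree X = ∏-squareFree _ (λ i → ∏-squareFree _
      (λ j → ∙-squareFree (unit (cell i j (proj₁ (X i)) (proj₂ (X i) j))) _ (unit-squareFree (cell i j _ _)) (unit-squareFree (mark i j _))
        λ v p q → cell≢mark (trans (unit-at⁻ _ p) (sym (unit-at⁻ _ q))))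
      (λ j j′ p q → proj₂ (positions (cellM-at⁻ i _ j _ p) (cellM-at⁻ i _ j′ _ q))))
    λ i i′ p q →
      let j , p′ = ∏-at⁻ _ p
          j′ , q′ = ∏-at⁻ _ q
      in proj₁ (positions (cellM-at⁻ i _ j _ p′) (cellM-at⁻ i′ _ j′ _ q′))
    where
    positions : ∀ {v i j c d i′ j′ c′ d′} → v ≡ cell i j c d ⊎ v ≡ mark i j d →
                v ≡ cell i′ j′ c′ d′ ⊎ v ≡ mark i′ j′ d′ → i ≡ i′ × j ≡ j′
    positions (inj₁ refl) (inj₁ eq) = proj₁ (cell-injective eq)
    positions (inj₁ refl) (inj₂ eq) = contradiction eq cell≢mark
    positions (inj₂ refl) (inj₁ eq) = contradiction (sym eq) cell≢mark
    positions (inj₂ refl) (inj₂ eq) = proj₁ (mark-injective eq)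

  columnsM-squareFree : ∀ y → SquareFree (columnsM y)
  columnsM-squareFree y = ∏-squareFree _ (λ j → ∏-squareFree _ (λ i → unit-squareFree (mark i j (y j)))
      λ i i′ p q → proj₁ (proj₁ (mark-injective (trans (unit-at⁻ _ p) (sym (unit-at⁻ _ q))))))
    λ j j′ p q → let i , eq = columnM-at⁻ j (y j) p
                     i′ , eq′ = columnM-at⁻ j′ (y j′) q
                 in proj₂ (proj₁ (mark-injective (trans (sym eq) eq′)))

  homogeneous-rows : Homogeneous (m′ * (m′ * 2)) rows
  homogeneous-rows = homogeneous-fold λ i → homogeneous-plus (row i false) (row i true)
    where
    cells : ∀ i c j d → Homogeneous 2 (cellFormula i c j d)
    cells i c j d = homogeneous-times homogeneous-leaf homogeneous-leaf
    row : ∀ i c → Homogeneous (m′ * 2) (rowFormula i c)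
    row i c = homogeneous-fold λ j → homogeneous-plus (cells i c j false) (cells i c j true)

  homogeneous-columns : Homogeneous (m′ * (m′ * 1)) columns
  homogeneous-columns = homogeneous-fold λ j → homogeneous-plus (column j false) (column j true)
    where
    column : ∀ j d → Homogeneous (m′ * 1) (columnFormula j d)
    column j d = homogeneous-fold {e = λ i → leaf (mark i j d)} λ i → homogeneous-leaf

  leaves-grid : leaves grid ≡ m′ * (m′ * 4 + m′ * 4) + m′ * (m′ * 1 + m′ * 1)
  leaves-grid = cong₂ _+_
    (leaves-fold times (λ i → node plus (rowFormula i false) (rowFormula i true)) _
      λ i → cong₂ _+_ (leaves-row i false) (leaves-row i true))
    (leaves-fold times (λ j → node plus (columnFormula j false) (columnFormula j true)) _
      λ j → cong₂ _+_ (leaves-column j false) (leaves-column j true))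
    where
    leaves-row : ∀ i c → leaves (rowFormula i c) ≡ m′ * 4
    leaves-row i c = leaves-fold times (λ j → node plus (cellFormula i c j false) (cellFormula i c j true)) 4 λ _ → refl
    leaves-column : ∀ j d → leaves (columnFormula j d) ≡ m′ * 1
    leaves-column j d = leaves-fold times (λ i → leaf (mark i j d)) 1 λ _ → refl

  -- A term before clipping: `X i` consists of the bit cᵢ and the bits dᵢⱼ, and y of the bits eⱼ.
  term : (Fin m′ → Bool × Choice) → Choice → Monomial n
  term X y = rowsM X ∙ columnsM y

  f∋⁻ : ∀ {μ} → f ∋ μ → ∃₂ λ X y → μ ≡ clip (term X y)
  f∋⁻ h with multilinearize∋⁻ (poly grid) h
  ... | ν , h′ , refl with ⊗∋⁻ (poly rows) (poly columns) h′
  ... | _ , _ , h₁ , h₂ , refl with rows∋⁻ h₁ | columns∋⁻ h₂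
  ... | X , refl | y , refl = X , y , refl

  f∋⁺ : ∀ X y → f ∋ clip (term X y)
  f∋⁺ X y = multilinearize∋⁺ (poly grid) (⊗∋⁺ (poly rows) (poly columns) (rows∋⁺ X) (columns∋⁺ y))

  f-positive : Positive f
  f-positive = positive-multilinearize (poly grid) (positive-poly grid)

  consistent : Choice → Choice → Fin m′ → Bool × Choice
  consistent x y i = x i , y

  -- The column part contributes marks only, so the cell variables depend on X alone.
  encodes : ∀ X y z → (∀ i j → proj₂ (X i) j ≡ z j) → Encodes cell (clip (term X y)) (proj₁ ∘ X) z
  encodes X y z D≡z = only , full
    where
    only : ∀ i j c d → clip (term X y) at cell i j c d → c ≡ proj₁ (X i) × d ≡ z j
    only i j c d h with at-∙⁻ (rowsM X) (columnsM y) _ (at-clip⁻ (term X y) h)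
    ... | inj₂ h₂ = contradiction (proj₂ (proj₂ (columnsM-at⁻ y h₂))) cell≢mark
    ... | inj₁ h₁ = go (rowsM-at⁻ X h₁) refl
      where
      go : ∀ {v} → InRows X v → v ≡ cell i j c d → c ≡ proj₁ (X i) × d ≡ z j
      go (in-mark _ _) eq = contradiction (sym eq) cell≢mark
      go (in-cell _ _) eq with cell-injective eq
      ... | (refl , refl) , (refl , refl) = refl , D≡z i j
    full : ∀ i j → clip (term X y) at cell i j (proj₁ (X i)) (z j)
    full i j = subst (λ d → clip (term X y) at cell i j (proj₁ (X i)) d) (D≡z i j)
      (at-clip⁺ (term X y) (at-∙⁺ˡ (rowsM X) (columnsM y) _ (rowsM-at⁺ X (in-cell i j))))

  InRows-mark : ∀ {X v} → InRows X v → ∀ {i j d} → v ≡ mark i j d → proj₂ (X i) j ≡ d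
  InRows-mark (in-cell _ _) eq = contradiction eq cell≢mark
  InRows-mark (in-mark _ _) eq with mark-injective eq
  ... | (refl , refl) , refl = refl

  degree-rowsM : ∀ X → degree (rowsM X) ≡ m′ * (m′ * 2)
  degree-rowsM X = degree≡ homogeneous-rows (rows∋⁺ X)

  degree-term : ∀ X y → degree (term X y) ≡ m′ * (m′ * 2) + m′ * (m′ * 1)
  degree-term X y = degree≡ (homogeneous-times homogeneous-rows homogeneous-columns)
    (⊗∋⁺ (poly rows) (poly columns) (rows∋⁺ X) (columns∋⁺ y))

  -- The row part is square-free of degree 2m² and survives clipping.
  degree≥rows : ∀ X y → m′ * (m′ * 2) ≤ degree (clip (term X y))
  degree≥rows X y = ≤-trans (≤-reflexive (sym (degree-rowsM X)))
    (degree-mono (rowsM X) (clip (term X y)) (squareFree-≤-clip (rowsM X) (columnsM y) (rowsM-squareFree X)))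

  degree≤rows : ∀ x y → degree (clip (term (consistent x y) y)) ≤ m′ * (m′ * 2)
  degree≤rows x y = ≤-trans (⊆⇒degree-clip-∙ (rowsM (consistent x y)) (columnsM y) columns⊆rows)
                            (≤-reflexive (degree-rowsM (consistent x y)))
    where
    columns⊆rows : ∀ {v} → columnsM y at v → rowsM (consistent x y) at v
    columns⊆rows h with columnsM-at⁻ y h
    ... | i , j , refl = rowsM-at⁺ (consistent x y) (in-mark i j)

  -- At the minimum degree each column mark must already occur in the row part, which has just one
  -- mark per cell, that of the bit dᵢⱼ.
  degree≤rows⇒consistent : ∀ X y → degree (clip (term X y)) ≤ m′ * (m′ * 2) → ∀ i j → proj₂ (X i) j ≡ y j
  degree≤rows⇒consistent X y le i j = InRows-mark (rowsM-at⁻ X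
    (degree-clip-∙⇒⊆ (rowsM X) (columnsM y) (rowsM-squareFree X)
      (≤-trans le (≤-reflexive (sym (degree-rowsM X)))) (columnsM-at⁺ y i j))) refl

  -- Every term has degree 3m² before clipping, which can only lower it.
  degree≤term : ∀ X y → degree (clip (term X y)) ≤ m′ * (m′ * 2) + m′ * (m′ * 1)
  degree≤term X y = ≤-trans (degree-mono (clip (term X y)) (term X y) (clip-≤ (term X y))) (≤-reflexive (degree-term X y))

  degree≥term : ∀ x y → m′ * (m′ * 2) + m′ * (m′ * 1) ≤ degree (clip (term (consistent x y) (not ∘ y)))
  degree≥term x y = ≤-trans (≤-reflexive (sym (degree-term X (not ∘ y)))) (squareFree⇒degree-clip (term X (not ∘ y))
    (∙-squareFree (rowsM X) (columnsM (not ∘ y)) (rowsM-squareFree X) (columnsM-squareFree (not ∘ y)) disjoint))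
    where
    X : Fin m′ → Bool × Choice
    X = consistent x y
    disjoint : ∀ v → rowsM X at v → ¬ columnsM (not ∘ y) at v
    disjoint v p q with columnsM-at⁻ (not ∘ y) q
    ... | i , j , eq = Bool.not-¬ refl (InRows-mark (rowsM-at⁻ X p) eq)

  -- Keeping degree 3m² means that clipping loses nothing, whereas dᵢⱼ = `y j` would make a mark
  -- occur twice.
  degree≥term⇒consistent : ∀ X y → m′ * (m′ * 2) + m′ * (m′ * 1) ≤ degree (clip (term X y)) →
                           ∀ i j → proj₂ (X i) j ≡ not (y j)
  degree≥term⇒consistent X y ge i j = Bool.¬-not λ D≡y → <⇒≱ (twice D≡y) (squareFree (mark i j (y j)))
    where
    squareFree : SquareFree (term X y)
    squareFree = degree-clip⇒squareFree (term X y) (≤-trans (≤-reflexive (degree-term X y)) ge)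
    twice : proj₂ (X i) j ≡ y j → 2 ≤ lookup (term X y) (mark i j (y j))
    twice D≡y = ≤-trans
      (+-mono-≤ (n≢0⇒n>0 (subst (λ d → rowsM X at mark i j d) D≡y (rowsM-at⁺ X (in-mark i j))))
                (n≢0⇒n>0 (columnsM-at⁺ y i j)))
      (≤-reflexive (sym (lookup-∙ (rowsM X) (columnsM y) _)))

  module Hard = Hardness {suc k} {n} cell (proj₁ ∘ proj₁ ∘ cell-injective)

  -- ≼ is ≤ for the lower and ≥ for the higher envelope.
  module Selected {_≼_ : ℕ → ℕ → Set} (_≼?_ : ∀ d e → Dec (d ≼ e)) (≼-trans : ∀ {c d e} → c ≼ d → d ≼ e → c ≼ e)
    (δ : ℕ) (flip? : Bool → Bool)
    (bound : ∀ X y → δ ≼ degree (clip (term X y)))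
    (reached : ∀ x y → degree (clip (term (consistent x y) (flip? ∘ y))) ≼ δ)
    (extremal : ∀ X y → degree (clip (term X y)) ≼ δ → ∀ i j → proj₂ (X i) j ≡ flip? (y j)) where

    open Envelope _≼?_

    selected⊆f : ∀ {t} → t ∈ envelope f → t ∈ f
    selected⊆f h = proj₁ (∈-envelope⁻ f f-positive h)

    sound : ∀ {μ} → envelope f ∋ μ → ∃₂ λ x y → Encodes cell μ x y
    sound {μ} (_ , h) with ∈-envelope⁻ f f-positive h
    ... | h′ , optimal with f∋⁻ (_ , h′)
    -- Any term of degree δ serves for comparison; the row bits in `consistent y y` are arbitrary.
    ... | X , y , refl = proj₁ ∘ X , flip? ∘ y , encodes X y _ (extremal X y
      (≼-trans (optimal (f∋⁺ (consistent y y) (flip? ∘ y))) (reached y y)))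

    complete : ∀ x → ∃[ μ ] envelope f ∋ μ × Encodes cell μ x x
    complete x = _ , (_ , ∈-envelope⁺ f (proj₂ (f∋⁺ (consistent x x) (flip? ∘ x))) optimal) ,
                 encodes (consistent x x) (flip? ∘ x) x (λ _ _ → refl)
      where
      optimal : ∀ {ν} → f ∋ ν → degree (clip (term (consistent x x) (flip? ∘ x))) ≼ degree ν
      optimal h with f∋⁻ h
      ... | X , y , refl = ≼-trans (reached x x) (bound X y)

    counted : ∃[ C ] C Counts envelope f
    -- The last expression, a membership in the envelope, rules out the empty list.
    counted with envelope f | selected⊆f | proj₂ (proj₁ (proj₂ (complete λ _ → false)))
    ... | t ∷ h | ⊆f | _ with sumOfTerms grid t h ⊆f
    ...   | e , eq = circuit e , subst (circuit e Counts_) eq (circuit-counts e)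

    hard : ∀ t → 2 ≤ t → 3 * t ≤ m′ → ∀ C → C Counts envelope f → 2 ^ t ≤ size C * 2
    hard = Hard.hard (envelope f) (f-positive ∘ selected⊆f) sound complete

  module Lower = Selected {_≤_} _≤?_ ≤-trans (m′ * (m′ * 2)) id
    degree≥rows degree≤rows degree≤rows⇒consistent

  module Higher = Selected {λ d e → e ≤ d} (λ d e → e ≤? d) (flip ≤-trans)
    (m′ * (m′ * 2) + m′ * (m′ * 1)) not
    degree≤term degree≥term degree≥term⇒consistent

-- Placing six variables per grid position

slot : (Bool × Bool) ⊎ Bool → Fin 6
slot (inj₁ (false , false)) = 0F
slot (inj₁ (false , true))  = 1F
slot (inj₁ (true  , false)) = 2F
slot (inj₁ (true  , true))  = 3F
slot (inj₂ false)           = 4F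
slot (inj₂ true)            = 5F

slot⁻¹ : Fin 6 → (Bool × Bool) ⊎ Bool
slot⁻¹ 0F = inj₁ (false , false)
slot⁻¹ 1F = inj₁ (false , true)
slot⁻¹ 2F = inj₁ (true  , false)
slot⁻¹ 3F = inj₁ (true  , true)
slot⁻¹ 4F = inj₂ false
slot⁻¹ 5F = inj₂ true

slot⁻¹∘slot : ∀ v → slot⁻¹ (slot v) ≡ v
slot⁻¹∘slot (inj₁ (false , false)) = refl
slot⁻¹∘slot (inj₁ (false , true))  = refl
slot⁻¹∘slot (inj₁ (true  , false)) = refl
slot⁻¹∘slot (inj₁ (true  , true))  = refl
slot⁻¹∘slot (inj₂ false)           = refl
slot⁻¹∘slot (inj₂ true)            = refl

gridNames : ∀ {m n} → m * (m * 6) ≤ n → Names m n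
gridNames {m} {n} le = record
  { cell           = λ i j c d → name i j (inj₁ (c , d))
  ; mark           = λ i j d → name i j (inj₂ d)
  ; cell-injective = λ eq → let ij , v≡w = name-injective eq in
                            ij , ,-injective (inj₁-injective v≡w)
  ; mark-injective = λ eq → let ij , v≡w = name-injective eq in ij , inj₂-injective v≡w
  ; cell≢mark      = λ eq → contradiction (proj₂ (name-injective eq)) λ ()
  }
  where
  name : Fin m → Fin m → (Bool × Bool) ⊎ Bool → Fin n
  name i j v = inject≤ (combine i (combine j (slot v))) le
  name-injective : ∀ {i j v i′ j′ w} → name i j v ≡ name i′ j′ w → (i ≡ i′ × j ≡ j′) × v ≡ w
  name-injective {i} {j} {v} {i′} {j′} {w} eq
    with Fin.combine-injective i (combine j (slot v)) i′ (combine j′ (slot w)) (Fin.inject≤-injective le le _ _ eq)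
  ... | i≡ , eq′ with Fin.combine-injective j (slot v) j′ (slot w) eq′
  ...   | j≡ , slot≡ = (i≡ , j≡) , trans (sym (slot⁻¹∘slot v)) (trans (cong slot⁻¹ slot≡) (slot⁻¹∘slot w))

-- The number 6m² of variables of the grid polynomial for m = 3 r.
area : ℕ → ℕ
area r = 3 * r * (3 * r * 6)

area-square : ∀ r → area r ≡ 54 * (r * r)
area-square = identity
  where
  identity : ∀ r → 3 * r * (3 * r * 6) ≡ 54 * (r * r)
  identity = solve-∀

area-mono-≤ : ∀ {r r′} → r ≤ r′ → area r ≤ area r′
area-mono-≤ r≤r′ = *-mono-≤ (*-monoʳ-≤ 3 r≤r′) (*-monoˡ-≤ 6 (*-monoʳ-≤ 3 r≤r′))

area-mono-< : ∀ {r r′} → r < r′ → area r < area r′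
area-mono-< r<r′ = *-mono-< (*-monoʳ-< 3 r<r′) (*-monoˡ-< 6 (*-monoʳ-< 3 r<r′))

-- The largest grid of side m = 3r that fits into n variables. The lower bound is applied with t =
-- r, and maximality gives r of order √n.
root : ∀ n → ∃[ r ] area r ≤ n × n < area (suc r)
root zero = 0 , z≤n , z<s
root (suc n) with root n
... | r , lo , hi with area (suc r) ≤? suc n
...   | yes le = suc r , le , ≤-<-trans hi (area-mono-< (n<1+n (suc r)))
...   | no ¬le = r , m≤n⇒m≤1+n lo , ≰⇒> ¬le

-- The family and its asymptotic bounds

gridPolynomial : ∀ n m → m * (m * 6) ≤ n → Polynomial n
-- A default value for n too small to hold a grid; the asymptotic bounds start later, at `area 2`.
gridPolynomial n zero    le = []
gridPolynomial n (suc k) le = Grid.f (gridNames {suc k} le)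

gridPolynomial-multilinear : ∀ n m le → Multilinear (gridPolynomial n m le)
gridPolynomial-multilinear n zero    le μ h = contradiction refl h
gridPolynomial-multilinear n (suc k) le     = multilinear-multilinearize (poly (Grid.grid (gridNames {suc k} le)))

-- The grid formula has 10m² leaves, against 12m² on the right.
gridSize : ∀ m → m * (m * 4 + m * 4) + m * (m * 1 + m * 1) ≤ 2 * (m * (m * 6))
gridSize m = ≤-trans (m≤m+n _ (2 * (m * m))) (≤-reflexive (identity m))
  where
  identity : ∀ m → m * (m * 4 + m * 4) + m * (m * 1 + m * 1) + 2 * (m * m) ≡ 2 * (m * (m * 6))
  identity = solve-∀

square-cancel-≤ : ∀ {p q} → p * p ≤ q * q → p ≤ q
square-cancel-≤ {p} {q} pp≤qq = ≮⇒≥ λ q<p → <⇒≱ (*-mono-< q<p q<p) pp≤qq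

-- 54 (r + 2)² ≤ 54 (3 r)² ≤ (23 r)² for r ≥ 1.
exponential : ∀ {n r s} → 1 ≤ r → n < area (suc (suc r)) → 2 ^ r ≤ s → 2^[√ n / 23 ]≤ s
exponential {n} {r} {s} 1≤r n< 2^r≤s p q p²≤nq² = begin
  2 ^ p               ≤⟨ ^-monoʳ-≤ 2 (square-cancel-≤ {p} {r * (23 * q)} p²≤) ⟩
  2 ^ (r * (23 * q))  ≡⟨ ^-*-assoc 2 r (23 * q) ⟨
  (2 ^ r) ^ (23 * q)  ≤⟨ ^-monoˡ-≤ (23 * q) 2^r≤s ⟩
  s ^ (23 * q)        ∎
  where
  open ≤-Reasoning
  r+2≤3r : suc (suc r) ≤ 3 * r
  r+2≤3r = ≤-trans (≤-reflexive (+-comm 2 r)) (+-monoʳ-≤ r (+-mono-≤ 1≤r (+-mono-≤ 1≤r z≤n)))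
  -- 54 · 9 = 486 falls short of 23² = 529 by 43.
  identity : ∀ r q → 54 * (3 * r * (3 * r)) * (q * q) + 43 * (r * r * (q * q)) ≡ r * (23 * q) * (r * (23 * q))
  identity = solve-∀
  square : ∀ x → x ^ 2 ≡ x * x
  square x = cong (x *_) (*-identityʳ x)
  p²≤ : p * p ≤ r * (23 * q) * (r * (23 * q))
  p²≤ = begin
    p * p                                    ≡⟨ square p ⟨
    p ^ 2                                    ≤⟨ p²≤nq² ⟩
    n * q ^ 2                                ≡⟨ cong (n *_) (square q) ⟩
    n * (q * q)                              ≤⟨ *-monoˡ-≤ (q * q) (<⇒≤ n<) ⟩
    area (suc (suc r)) * (q * q)             ≡⟨ cong (_* (q * q)) (area-square (suc (suc r))) ⟩
    54 * (suc (suc r) * suc (suc r)) * (q * q)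
      ≤⟨ *-monoˡ-≤ (q * q) (*-monoʳ-≤ 54 (*-mono-≤ r+2≤3r r+2≤3r)) ⟩
    54 * (3 * r * (3 * r)) * (q * q)         ≤⟨ m≤m+n _ (43 * (r * r * (q * q))) ⟩
    54 * (3 * r * (3 * r)) * (q * q) + 43 * (r * r * (q * q)) ≡⟨ identity r q ⟩
    r * (23 * q) * (r * (23 * q))            ∎

Hard : ℕ → Polynomial n → Set
Hard t h = (∃[ C ] C Counts h) × (∀ C → C Counts h → 2 ^ t ≤ size C * 2)

exponential-size : ∀ {n r} {h : Polynomial n} → 2 ≤ r → n < area (suc r) → Hard r h →
                   ∃[ s ] (C₀₁ h Is s) × (2^[√ n / 23 ]≤ s)
-- Cancelling the 2 in 2^(r+1) ≤ 2s leaves the exponent r, hence the bound n < `area` (r + 2) in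
-- `exponential`.
exponential-size {n} {suc r} {h} (s≤s 1≤r) n< ((C , counts) , hard) with minimalSize h C counts
... | s , is , _ = s , is , exponential {n} {r} {s} 1≤r n<
        (*-cancelˡ-≤ 2 (≤-trans (bound (C₀₁_Is_.attained is)) (≤-reflexive (*-comm s 2))))
  where
  bound : ∃[ D ] D Counts h × size D ≡ s → 2 ^ suc r ≤ s * 2
  bound (D , k , refl) = hard D k

gridPolynomial-linear : ∀ n m le → 0 < m → ∃[ s ] (C₀₁ gridPolynomial n m le Is s) × (s ≤ 2 * n)
gridPolynomial-linear n (suc k) le _ with minimalSize f (circuit grid) (circuit-counts grid)
  where open Grid (gridNames {suc k} le)
... | s , is , s≤ = s , is , (begin
    s                                               ≤⟨ s≤ ⟩
    size (circuit grid)                             ≤⟨ size-circuit grid ⟩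
    leaves grid                                     ≡⟨ leaves-grid ⟩
    m′ * (m′ * 4 + m′ * 4) + m′ * (m′ * 1 + m′ * 1) ≤⟨ gridSize m′ ⟩
    2 * (m′ * (m′ * 6))                             ≤⟨ *-monoʳ-≤ 2 le ⟩
    2 * n                                           ∎)
    where
    open ≤-Reasoning
    open Grid (gridNames {suc k} le)

gridPolynomial-hard : ∀ n m le t → 2 ≤ t → 3 * t ≤ m →
  Hard t (higherEnvelope (gridPolynomial n m le)) × Hard t (lowerEnvelope (gridPolynomial n m le))
gridPolynomial-hard n zero    le (suc t) _   ()
gridPolynomial-hard n (suc k) le t       2≤t 3t≤m =
  (Higher.counted , Higher.hard t 2≤t 3t≤m) , (Lower.counted , Lower.hard t 2≤t 3t≤m)
  where open Grid (gridNames {suc k} le)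

family : ∀ n → Polynomial n
family n = gridPolynomial n (3 * proj₁ (root n)) (proj₁ (proj₂ (root n)))

family-multilinear : ∀ n → Multilinear (family n)
family-multilinear n = gridPolynomial-multilinear n (3 * proj₁ (root n)) (proj₁ (proj₂ (root n)))

-- The descent requires t = r ≥ 2, which fixes the threshold `area 2` for the asymptotic bounds.
2≤root : ∀ n → area 2 ≤ n → 2 ≤ proj₁ (root n)
2≤root n n≥ = ≮⇒≥ λ r<2 → <⇒≱ (<-≤-trans (proj₂ (proj₂ (root n))) (area-mono-≤ r<2)) n≥

family-linear : ∀ n → area 2 ≤ n → ∃[ s ] (C₀₁ family n Is s) × (s ≤ 2 * n)
family-linear n n≥ = gridPolynomial-linear n (3 * proj₁ (root n)) (proj₁ (proj₂ (root n)))
  (≤-trans (≤-trans (s≤s z≤n) (2≤root n n≥)) (m≤n*m _ 3))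

family-hard : ∀ n → area 2 ≤ n →
  (∃[ s ] (C₀₁ higherEnvelope (family n) Is s) × (2^[√ n / 23 ]≤ s)) ×
  (∃[ s ] (C₀₁ lowerEnvelope (family n) Is s) × (2^[√ n / 23 ]≤ s))
family-hard n n≥ with root n | 2≤root n n≥
... | r , lo , hi | 2≤r with gridPolynomial-hard n (3 * r) lo r 2≤r ≤-refl
...   | higher , lower = exponential-size 2≤r hi higher , exponential-size 2≤r hi lower

-- The common family has linear size, and n ≤ n^(3/2) turns this into the bound claimed for g.
linear≤·√cubic : ∀ {n s} → 1 ≤ n → s ≤ 2 * n → s ≤ 2 ·√ (n ^ 3)
linear≤·√cubic {n} {s} 1≤n s≤2n = begin
  s ^ 2              ≤⟨ ^-monoˡ-≤ 2 s≤2n ⟩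
  (2 * n) ^ 2        ≡⟨ square n ⟩
  2 ^ 2 * n ^ 2      ≤⟨ *-monoʳ-≤ 4 (^-monoʳ-≤ n {{>-nonZero 1≤n}} (n≤1+n 2)) ⟩
  2 ^ 2 * n ^ 3      ∎
  where
  open ≤-Reasoning
  square : ∀ n → (2 * n) * ((2 * n) * 1) ≡ 4 * (n * (n * 1))
  square = solve-∀

theorem2 : Σ ((n : ℕ) → Polynomial n) λ f → Σ ((n : ℕ) → Polynomial n) λ g →
    (∀ n → Multilinear (f n)) ×
    (∀ n → Multilinear (g n)) ×
    (∃[ c ] Eventually (λ n → ∃[ s ] (C₀₁ (f n) Is s) × (s ≤ c * n))) ×
    (∃[ c ] Eventually (λ n → ∃[ s ] (C₀₁ (g n) Is s) × (s ≤ c ·√ (n ^ 3)))) ×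
    (∃[ k ] (0 < k) × Eventually (λ n → ∃[ s ] (C₀₁ (higherEnvelope (f n)) Is s) × (2^[√ n / k ]≤ s))) ×
    (∃[ k ] (0 < k) × Eventually (λ n → ∃[ s ] (C₀₁ (lowerEnvelope (g n)) Is s) × (2^[√ n / k ]≤ s)))
theorem2 =
  family , family , family-multilinear , family-multilinear ,
  (2 , area 2 , family-linear) ,
  (2 , area 2 , λ n n≥ → let s , is , s≤ = family-linear n n≥
                         in s , is , linear≤·√cubic {n} {s} (≤-trans (s≤s z≤n) n≥) s≤) ,
  (23 , z<s , area 2 , λ n n≥ → proj₁ (family-hard n n≥)) ,
  (23 , z<s , area 2 , λ n n≥ → proj₂ (family-hard n n≥))
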